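{- Let $M$ be a positroid of rank $d$ on $[n]$ and let $\Gamma_M$ be its matroid polytope. Then the face poset of $\Gamma_M$ (all faces, including the empty face, ordered by inclusion) is isomorphic to an induced subposet of $NC_n^d \cup \{\widehat{0}\}$; that is, there is an injective map $\phi$ from the set of faces of $\Gamma_M$ to $NC_n^d\cup\{\widehat 0\}$ such that $F\subseteq G$ if and only if $\phi(F)\leq\phi(G)$.
   Context: A matroid $M$ on $[n]$ is a positroid if there is a real $d\times n$ matrix of rank $d$ with all maximal minors nonnegative whose column matroid is $M$ (column $i$ corresponding to element $i$). The matroid polytope is $\Gamma_M=\mathrm{conv}\{e_B : B \text{ a basis of } M\}\subset\mathbb{R}^n$, where $e_B=\sum_{i\in B}e_i$. A partition of $[n]$ into nonempty blocks is non-crossing if there are no $a,b,c,d$ in cyclic order with $a,c$ in one block and $b,d$ in a different block. A weighted non-crossing partition of $[n]$ is a non-crossing partition $\{S_1,\dots,S_t\}$ together with integer weights $w(S_i)$ with $0\leq w(S_i)\leq |S_i|$; its weight is $\sum_i w(S_i)$. $NC_n^d$ is the set of weighted non-crossing partitions of $[n]$ of weight $d$, partially ordered by the reflexive-transitive closure of the following cover relation: $S^w \lessdot T^v$ if $T=\{T_1,\dots,T_t\}$ and $S=\{T_1,\dots,T_{h-1},A,T_h - A,T_{h+1},\dots,T_t\}$ for some index $h$ and some $\emptyset\subsetneq A\subsetneq T_h$, with $v(T_h)=w(A)+w(T_h-A)$ and $v(T_j)=w(T_j)$ for $j\neq h$. $NC_n^d\cup\{\widehat 0\}$ is this poset with a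 new minimum element $\widehat 0$ adjoined. -}

module Defs where

open import Level using (0ℓ)
open import Data.Nat as ℕ using (ℕ; zero; suc; _≟_)
open import Data.Bool using (Bool; true; false; if_then_else_)
open import Data.Fin as Fin using (Fin; zero; suc; punchIn; cast; _<_)
open import Data.Fin.Subset as Sub using (Subset; _∈_; _∩_; ∁; _⊂_; Nonempty; Empty; ∣_∣)
open import Data.Vec as Vec using (Vec; []; _∷_)
open import Data.List as List using (List; []; _∷_; _++_; length; lookup; map)
open import Data.Nat.ListAction using (sum)
open import Data.List.Relation.Unary.All using (All)
open import Data.List.Relation.Unary.Any using (Any)
open import Data.List.Relation.Unary.AllPairs using (AllPairs)
open import Data.List.Relation.Binary.Permutation.Propositional using (_↭_)
open import Data.Product using (Σ; ∃; ∃-syntax; _×_; _,_; proj₁; proj₂)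
open import Data.Sum using (_⊎_)
open import Data.Maybe using (Maybe; just; nothing)
open import Data.Unit using (⊤)
open import Data.Empty using (⊥)
open import Relation.Nullary using (¬_; yes; no)
open import Relation.Binary.PropositionalEquality using (_≡_; _≢_)
open import Relation.Binary.Structures using (IsTotalOrder)
open import Relation.Binary.Construct.Closure.ReflexiveTransitive using (Star)
open import Algebra.Bundles using (CommutativeRing)

record CompleteOrderedField : Set₁ where
  field
    commutativeRing : CommutativeRing 0ℓ 0ℓ
  open CommutativeRing commutativeRing public
  infix 4 _≤_
  field
    _≤_           : Carrier → Carrier → Set
    ≤-isTotalOrder : IsTotalOrder _≈_ _≤_
    0≉1           : ¬ (0# ≈ 1#)
    inverse       : ∀ x → ¬ (x ≈ 0#) → ∃[ y ] (x * y ≈ 1#)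
    +-mono-≤      : ∀ {x y} z → x ≤ y → x + z ≤ y + z
    *-nonneg      : ∀ {x y} → 0# ≤ x → 0# ≤ y → 0# ≤ x * y
    sup           : (P : Carrier → Set) → (∃[ x ] P x) →
                    (∃[ b ] (∀ x → P x → x ≤ b)) →
                    ∃[ s ] ((∀ x → P x → x ≤ s) ×
                            (∀ b → (∀ x → P x → x ≤ b) → s ≤ b))

elems : ∀ {n} → Subset n → List (Fin n)
elems {zero}  []      = []
elems {suc n} (b ∷ p) = (if b then zero ∷ [] else []) ++ map suc (elems p)

module WithField (R : CompleteOrderedField) where
  open CompleteOrderedField R
    using (Carrier; _≈_; _≤_; _+_; _*_; -_; 0#; 1#)

  sumF : (k : ℕ) → (Fin k → Carrier) → Carrier
  sumF zero    f = 0#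
  sumF (suc k) f = f zero + sumF k (λ i → f (suc i))

  alt : ℕ → Carrier
  alt zero    = 1#
  alt (suc m) = - alt m

  det : (k : ℕ) → (Fin k → Fin k → Carrier) → Carrier
  det zero    M = 1#
  det (suc k) M = sumF (suc k) (λ j →
                    alt (Fin.toℕ j) * M zero j * det k (λ r c → M (suc r) (punchIn j c)))

  -- maximal minor Δ_B(A) of a d×n matrix (only meaningful when |B| = d;
  -- it is set to 0 otherwise and only ever used when |B| = d)
  minor : ∀ {d n} → (Fin d → Fin n → Carrier) → Subset n → Carrier
  minor {d} A B with d ≟ length (elems B)
  ... | yes eq = det d (λ r c → A r (lookup (elems B) (cast eq c)))
  ... | no  _  = 0#

  HasRank : ∀ {d n} → (Fin d → Fin n → Carrier) → Set
  HasRank {d} {n} A = (c : Fin d → Carrier) →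
    (∀ j → sumF d (λ i → c i * A i j) ≈ 0#) → ∀ i → c i ≈ 0#

  TNN : ∀ {d n} → (Fin d → Fin n → Carrier) → Set
  TNN {d} {n} A = (B : Subset n) → ∣ B ∣ ≡ d → 0# ≤ minor A B

  IsBasis : ∀ {d n} → (Fin d → Fin n → Carrier) → Subset n → Set
  IsBasis {d} A B = ∣ B ∣ ≡ d × ¬ (minor A B ≈ 0#)

  Point : ℕ → Set
  Point n = Fin n → Carrier

  e : ∀ {n} → Subset n → Point n
  e B i = if Vec.lookup B i then 1# else 0#

  _·_ : ∀ {n} → Point n → Point n → Carrier
  _·_ {n} w x = sumF n (λ i → w i * x i)

  InPolytope : ∀ {d n} → (Fin d → Fin n → Carrier) → Point n → Set
  InPolytope {d} {n} A x =
    ∃[ k ] Σ (Fin k → Carrier) λ λs → Σ (Fin k → Subset n) λ Bs →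
      (∀ j → 0# ≤ λs j) × sumF k λs ≈ 1# × (∀ j → IsBasis A (Bs j)) ×
      (∀ i → x i ≈ sumF k (λ j → λs j * e (Bs j) i))

  -- a face of Γ_M: the empty face, or the set of maximisers over Γ_M
  -- of a linear functional w (w = 0 gives Γ_M itself)
  IsFace : ∀ {d n} → (Fin d → Fin n → Carrier) → (Point n → Set) → Set
  IsFace {d} {n} A F =
    (∀ x → ¬ F x) ⊎
    (∃[ w ] ∀ x → (F x → (InPolytope A x × (∀ y → InPolytope A y → w · y ≤ w · x))) ×
                  ((InPolytope A x × (∀ y → InPolytope A y → w · y ≤ w · x)) → F x))

  Face : ∀ {d n} → (Fin d → Fin n → Carrier) → Set₁
  Face {d} {n} A = Σ (Point n → Set) (IsFace A)

  _⊆F_ : ∀ {d n} {A : Fin d → Fin n → Carrier} → Face A → Face A → Set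
  F ⊆F G = ∀ x → proj₁ F x → proj₁ G x

-- Weighted non-crossing partitions of [n] = Fin n.
-- A weighted partition is a list of (block, weight) pairs; two such lists
-- denote the same weighted partition iff they are permutations of each other.

WPart : ℕ → Set
WPart n = List (Subset n × ℕ)

Cyclic : ∀ {n} → Fin n → Fin n → Fin n → Fin n → Set
Cyclic a b c d = (a < b × b < c × c < d) ⊎ (b < c × c < d × d < a) ⊎
                 (c < d × d < a × a < b) ⊎ (d < a × a < b × b < c)

Cross : ∀ {n} → Subset n → Subset n → Set
Cross {n} S T = ∃[ a ] ∃[ b ] ∃[ c ] ∃[ d ]
  (Cyclic a b c d × a ∈ S × c ∈ S × b ∈ T × d ∈ T)

blockSum : ∀ {n} → WPart n → ℕ
blockSum P = sum (map proj₂ P)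

record IsWNC (n d : ℕ) (P : WPart n) : Set where
  field
    nonempty   : All (λ Sw → Nonempty (proj₁ Sw)) P
    disjoint   : AllPairs (λ Sw Tv → Empty (proj₁ Sw ∩ proj₁ Tv)) P
    covering   : ∀ i → Any (λ Sw → i ∈ proj₁ Sw) P
    noncrossing : AllPairs (λ Sw Tv → ¬ Cross (proj₁ Sw) (proj₁ Tv) × ¬ Cross (proj₁ Tv) (proj₁ Sw)) P
    weightBound : All (λ Sw → proj₂ Sw ℕ.≤ ∣ proj₁ Sw ∣) P
    totalWeight : blockSum P ≡ d

NC : ℕ → ℕ → Set
NC n d = Σ (WPart n) (IsWNC n d)

_⋖_ : ∀ {n} → WPart n → WPart n → Set
_⋖_ {n} S T = ∃[ rest ] ∃[ Th ] ∃[ A ] ∃[ a ] ∃[ b ]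
  (Nonempty A × A ⊂ Th ×
   T ↭ ((Th , a ℕ.+ b) ∷ rest) ×
   S ↭ ((A , a) ∷ (Th ∩ ∁ A , b) ∷ rest))

-- the order of NC_n^d: reflexive-transitive closure of the cover relation
-- (identity of weighted partitions being list permutation)
_≤NC_ : ∀ {n d} → NC n d → NC n d → Set
_≤NC_ = Star (λ S T → (proj₁ S ⋖ proj₁ T) ⊎ (proj₁ S ↭ proj₁ T))

NCHat : ℕ → ℕ → Set
NCHat n d = Maybe (NC n d)

_≤̂_ : ∀ {n d} → NCHat n d → NCHat n d → Set
nothing ≤̂ _       = ⊤
just _  ≤̂ nothing = ⊥
just x  ≤̂ just y  = x ≤NC y

_≈̂_ : ∀ {n d} → NCHat n d → NCHat n d → Set
nothing ≈̂ nothing = ⊤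
just x  ≈̂ just y  = proj₁ x ↭ proj₁ y
_       ≈̂ _       = ⊥

{-# OPTIONS --safe #-}
module Submission where

-- The face of w is sent to the connected components of the matroid of w-maximal bases,
-- weighted by the sizes of their intersections with any such basis.
--
-- With ω the wedge of the rows of A, the contractions of ω lie in the span of the rows,
-- so wedging them with ω gives zero: Σ_j ± ω(I + j) ω(J - j) = 0. As the minors are
-- nonnegative, a nonzero term forces one of the opposite sign, and since all terms have
-- the same w-weight this signed exchange property passes to the w-maximal bases. It
-- contains the symmetric exchange axiom as well as the positive three-term Plücker
-- relations; the latter forbid two crossing exchanges in different components, so that
-- the components form a non-crossing partition.
--
-- The affine span of a face is cut out by the weights of its components, so a face is
-- determined by its weighted partition and inclusion of faces is refinement. A refinement
-- of non-crossing partitions is a chain of covers: merge, one pair at a time, the blocks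
-- of two nearest elements that still have to be joined.
--
-- Constructively, completeness and totality of the order of the field decide every
-- stable proposition, in particular equality, being a basis, and being in the same component.

open import Defs
open import Level using (0ℓ)
open import Algebra.Bundles using (CommutativeRing)
import Algebra.Solver.Ring
import Algebra.Solver.Ring.AlmostCommutativeRing as ACR
open import Data.Bool using (Bool; true; false; if_then_else_; not; _xor_; _∧_)
import Data.Bool.Properties as Bool
open import Data.Empty using (⊥; ⊥-elim)
open import Data.Fin as Fin using (Fin; zero; suc; toℕ; punchIn; cast; _<_)
import Data.Fin.Properties as Fin
open import Data.Fin.Subset using (Subset; ∣_∣; _∩_; _∪_; ∁; _∈_; _∉_; _⊆_; Nonempty; Empty)
import Data.Fin.Subset.Properties as Sub
open import Data.Integer as ℤ using (ℤ; +_; -[1+_]; _⊖_)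
import Data.Integer.Properties as ℤ
open import Data.List as List using (List; []; _∷_; map; length; deduplicate; allFin)
open import Data.List.Membership.Propositional using () renaming (_∈_ to _∈ˡ_; find to findˡ; lose to loseˡ)
open import Data.List.Membership.Propositional.Properties using (∈-∃++; ∈-map⁻; ∈-allFin)
open import Data.List.Membership.Propositional.Properties.WithK using (unique∧set⇒bag)
import Data.List.Properties as List
open import Data.List.Relation.Binary.BagAndSetEquality using (∼bag⇒↭)
open import Data.List.Relation.Binary.Permutation.Propositional using (_↭_; ↭-sym; ↭-trans; ↭-reflexive; ↭-prep; ↭⇒↭ₛ)
import Data.List.Relation.Binary.Permutation.Propositional.Properties as ↭
import Data.List.Relation.Binary.Permutation.Setoid.Properties as ↭ₛ
open import Data.List.Relation.Unary.All as All using (All; []; _∷_)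
import Data.List.Relation.Unary.All.Properties as All
open import Data.List.Relation.Unary.AllPairs as AllPairs using (AllPairs; []; _∷_)
import Data.List.Relation.Unary.AllPairs.Properties as AllPairs
open import Data.List.Relation.Unary.Any as Any using (Any; here; there)
import Data.List.Relation.Unary.Any.Properties as Any
open import Data.List.Relation.Unary.Unique.DecSetoid.Properties using (deduplicate-!)
open import Data.Maybe using (Maybe; just; nothing)
open import Data.Nat as ℕ using (ℕ; zero; suc)
import Data.Nat.Properties as ℕ
open import Data.Product using (Σ; ∃-syntax; _×_; _,_; proj₁; proj₂; swap)
open import Data.Sum using (_⊎_; inj₁; inj₂; [_,_]′)
open import Data.Unit using (tt)
open import Data.Vec as Vec using ([]; _∷_; _[_]≔_) renaming (lookup to infixl 9 _!_)
import Data.Vec.Properties as Vec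
open import Function using (_∘_; case_of_; mk⇔)
open import Relation.Binary.Bundles using (DecSetoid)
open import Relation.Binary.Construct.Closure.ReflexiveTransitive using (ε; _◅_; _◅◅_)
open import Relation.Binary.Definitions using (tri<; tri≈; tri>; Symmetric)
open import Relation.Binary.PropositionalEquality as ≡ using (_≡_; _≢_; refl; sym; trans; cong; cong₂; subst)
open import Relation.Binary.Structures using (IsTotalOrder)
open import Relation.Nullary using (¬_; Dec; yes; no; does; contradiction)
open import Relation.Nullary.Decidable using (decidable-stable; dec-true; _×-dec_; ¬?)

-- Ring normalisation over an abstract commutative ring.

-- Coefficients in ℤ let the ring solver cancel opposite terms over an abstract ring.
module IntegerCoefficients (K : CommutativeRing 0ℓ 0ℓ) where
  open CommutativeRing K renaming (refl to ≈-refl; sym to ≈-sym; trans to ≈-trans)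
  open import Algebra.Properties.Ring ring
  open import Algebra.Properties.AbelianGroup +-abelianGroup using (⁻¹-∙-comm)
  open import Algebra.Properties.Semiring.Mult.TCOptimised semiring
    renaming (_×_ to _×′_) using (1+×; ×-homo-+; ×1-homo-*)
  open import Relation.Binary.Reasoning.Setoid setoid

  ⟦_⟧ : ℤ → Carrier
  ⟦ + n ⟧      = n ×′ 1#
  ⟦ -[1+ n ] ⟧ = - (suc n ×′ 1#)

  neg-homo : ∀ z → ⟦ ℤ.- z ⟧ ≈ - ⟦ z ⟧
  neg-homo (+ zero)   = ≈-sym -0#≈0#
  neg-homo (+ suc n)  = ≈-refl
  neg-homo -[1+ n ]   = ≈-sym (-‿involutive _)

  ⊖-homo : ∀ m n → ⟦ m ⊖ n ⟧ ≈ m ×′ 1# + - (n ×′ 1#)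
  ⊖-homo m zero = ≈-sym (≈-trans (+-congˡ -0#≈0#) (+-identityʳ _))
  ⊖-homo zero (suc n) = ≈-sym (+-identityˡ _)
  ⊖-homo (suc m) (suc n) = begin
    ⟦ suc m ⊖ suc n ⟧                  ≡⟨ cong ⟦_⟧ (ℤ.[1+m]⊖[1+n]≡m⊖n m n) ⟩
    ⟦ m ⊖ n ⟧                          ≈⟨ ⊖-homo m n ⟩
    x + - y                            ≈⟨ +-congʳ (+-identityˡ x) ⟨
    0# + x + - y                       ≈⟨ +-congʳ (+-congʳ (-‿inverseʳ 1#)) ⟨
    1# + - 1# + x + - y                ≈⟨ +-congʳ (+-assoc 1# (- 1#) x) ⟩
    1# + (- 1# + x) + - y              ≈⟨ +-congʳ (+-congˡ (+-comm (- 1#) x)) ⟩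
    1# + (x + - 1#) + - y              ≈⟨ +-congʳ (+-assoc 1# x (- 1#)) ⟨
    1# + x + - 1# + - y                ≈⟨ +-assoc (1# + x) (- 1#) (- y) ⟩
    1# + x + (- 1# + - y)              ≈⟨ +-congˡ (⁻¹-∙-comm 1# y) ⟩
    1# + x + - (1# + y)                ≈⟨ +-cong (1+× m 1#) (-‿cong (1+× n 1#)) ⟨
    suc m ×′ 1# + - (suc n ×′ 1#)      ∎
    where x = m ×′ 1# ; y = n ×′ 1#

  +-homo : ∀ x y → ⟦ x ℤ.+ y ⟧ ≈ ⟦ x ⟧ + ⟦ y ⟧
  +-homo (+ m)    (+ n)    = ×-homo-+ 1# m n
  +-homo (+ m)    -[1+ n ] = ⊖-homo m (suc n)
  +-homo -[1+ m ] (+ n)    = ≈-trans (⊖-homo n (suc m)) (+-comm _ _)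
  +-homo -[1+ m ] -[1+ n ] = begin
    - (suc (suc (m ℕ.+ n)) ×′ 1#)        ≡⟨ cong (λ k → - (suc k ×′ 1#)) (ℕ.+-suc m n) ⟨
    - ((suc m ℕ.+ suc n) ×′ 1#)          ≈⟨ -‿cong (×-homo-+ 1# (suc m) (suc n)) ⟩
    - (suc m ×′ 1# + suc n ×′ 1#)        ≈⟨ ⁻¹-∙-comm _ _ ⟨
    - (suc m ×′ 1#) + - (suc n ×′ 1#)    ∎

  *-homo⁺ : ∀ x n → ⟦ x ℤ.* + n ⟧ ≈ ⟦ x ⟧ * ⟦ + n ⟧
  *-homo⁺ (+ m) n = begin
    ⟦ + m ℤ.* + n ⟧    ≡⟨ cong ⟦_⟧ (ℤ.pos-* m n) ⟨
    (m ℕ.* n) ×′ 1#    ≈⟨ ×1-homo-* m n ⟩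
    m ×′ 1# * n ×′ 1#  ∎
  *-homo⁺ x@(-[1+ m ]) n = begin
    ⟦ x ℤ.* + n ⟧                  ≡⟨ cong ⟦_⟧ (ℤ.neg-distribˡ-* (+ suc m) (+ n)) ⟨
    ⟦ ℤ.- (+ suc m ℤ.* + n) ⟧      ≈⟨ neg-homo (+ suc m ℤ.* + n) ⟩
    - ⟦ + suc m ℤ.* + n ⟧          ≈⟨ -‿cong (*-homo⁺ (+ suc m) n) ⟩
    - (suc m ×′ 1# * n ×′ 1#)      ≈⟨ -‿distribˡ-* _ _ ⟩
    - (suc m ×′ 1#) * n ×′ 1#      ∎

  *-homo : ∀ x y → ⟦ x ℤ.* y ⟧ ≈ ⟦ x ⟧ * ⟦ y ⟧
  *-homo x (+ n) = *-homo⁺ x n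
  *-homo x y@(-[1+ n ]) = begin
    ⟦ x ℤ.* y ⟧                    ≡⟨ cong ⟦_⟧ (ℤ.neg-distribʳ-* x (+ suc n)) ⟨
    ⟦ ℤ.- (x ℤ.* + suc n) ⟧        ≈⟨ neg-homo (x ℤ.* + suc n) ⟩
    - ⟦ x ℤ.* + suc n ⟧            ≈⟨ -‿cong (*-homo⁺ x (suc n)) ⟩
    - (⟦ x ⟧ * suc n ×′ 1#)        ≈⟨ -‿distribʳ-* _ _ ⟩
    ⟦ x ⟧ * - (suc n ×′ 1#)        ∎

  morphism : ℤ.+-*-rawRing ACR.-Raw-AlmostCommutative⟶ ACR.fromCommutativeRing K
  morphism = record
    { ⟦_⟧ = ⟦_⟧ ; +-homo = +-homo ; *-homo = *-homo ; -‿homo = neg-homo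
    ; 0-homo = ≈-refl ; 1-homo = ≈-refl }

  _≟⟦⟧_ : ∀ x y → Maybe (⟦ x ⟧ ≈ ⟦ y ⟧)
  x ≟⟦⟧ y with x ℤ.≟ y
  ... | yes x≡y = just (reflexive (cong ⟦_⟧ x≡y))
  ... | no  _   = nothing

  open Algebra.Solver.Ring ℤ.+-*-rawRing (ACR.fromCommutativeRing K) morphism _≟⟦⟧_ public
    using (Polynomial; solve; con; _:=_; _:+_; _:*_; :-_)

  :0 :1 : ∀ {n} → Polynomial n
  :0 = con (+ 0)
  :1 = con (+ 1)

-- Complete ordered fields: order, decidability and finite sums.

module OrderedField (R : CompleteOrderedField) where
  open CompleteOrderedField R hiding (zero) renaming (refl to ≈-refl; sym to ≈-sym; trans to ≈-trans)
  open WithField R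
  open IntegerCoefficients commutativeRing using (solve; _:=_; _:+_; _:*_; :-_; :0; :1)
  open IsTotalOrder ≤-isTotalOrder public
    using () renaming (total to ≤-total; trans to ≤-trans; antisym to ≤-antisym; reflexive to ≤-reflexive)

  ≤-refl : ∀ {x} → x ≤ x
  ≤-refl = ≤-reflexive ≈-refl

  ≤-resp : ∀ {x x′ y y′} → x ≈ x′ → y ≈ y′ → x ≤ y → x′ ≤ y′
  ≤-resp x≈x′ y≈y′ x≤y = ≤-trans (≤-reflexive (≈-sym x≈x′)) (≤-trans x≤y (≤-reflexive y≈y′))

  x≤y⇒0≤y-x : ∀ {x y} → x ≤ y → 0# ≤ y + - x
  x≤y⇒0≤y-x {x} x≤y = ≤-resp (-‿inverseʳ x) ≈-refl (+-mono-≤ (- x) x≤y)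

  0≤y-x⇒x≤y : ∀ {x y} → 0# ≤ y + - x → x ≤ y
  0≤y-x⇒x≤y {x} {y} h = ≤-resp (+-identityˡ x) (solve 2 (λ x y → y :+ :- x :+ x := y) ≈-refl x y) (+-mono-≤ x h)

  neg-mono : ∀ {x y} → x ≤ y → - y ≤ - x
  neg-mono {x} {y} h = 0≤y-x⇒x≤y (≤-resp ≈-refl (solve 2 (λ x y → y :+ :- x := :- x :+ :- :- y) ≈-refl x y) (x≤y⇒0≤y-x h))

  +-mono₂ : ∀ {a b c d} → a ≤ b → c ≤ d → a + c ≤ b + d
  +-mono₂ {a} {b} {c} {d} h k =
    ≤-trans (+-mono-≤ c h) (≤-resp (+-comm c b) (+-comm d b) (+-mono-≤ b k))

  *-monoˡ : ∀ {a b c} → 0# ≤ c → a ≤ b → c * a ≤ c * b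
  *-monoˡ {a} {b} {c} h k = 0≤y-x⇒x≤y (≤-resp ≈-refl
    (solve 3 (λ a b c → c :* (b :+ :- a) := c :* b :+ :- (c :* a)) ≈-refl a b c)
    (*-nonneg h (x≤y⇒0≤y-x k)))

  0≤-x : ∀ {x} → x ≤ 0# → 0# ≤ - x
  0≤-x h = ≤-resp ≈-refl (+-identityˡ _) (x≤y⇒0≤y-x h)

  -- Totality leaves only the case 1 ≤ 0; then -1 is nonnegative, and so is its square 1.
  0≤1 : 0# ≤ 1#
  0≤1 with ≤-total 0# 1#
  ... | inj₁ h = h
  ... | inj₂ h = ≤-resp ≈-refl (solve 0 (:- :1 :* :- :1 := :1) ≈-refl) (*-nonneg (0≤-x h) (0≤-x h))

  1≰0 : ¬ (1# ≤ 0#)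
  1≰0 h = 0≉1 (≤-antisym 0≤1 h)

  -- The supremum of {-1} ∪ {1 | Q} is ≤ 0 or ≥ 0, which decides ¬ Q.
  weak-excluded-middle : (Q : Set) → ¬ Q ⊎ ¬ ¬ Q
  weak-excluded-middle Q = decide (sup P (- 1# , inj₁ ≈-refl) (1# , bounded))
    where
    P : Carrier → Set
    P x = x ≈ - 1# ⊎ (x ≈ 1# × Q)
    -1≤0 : - 1# ≤ 0#
    -1≤0 = ≤-resp ≈-refl (solve 0 (:- :0 := :0) ≈-refl) (neg-mono 0≤1)
    bounded : ∀ x → P x → x ≤ 1#
    bounded x (inj₁ x≈-1) = ≤-trans (≤-reflexive x≈-1) (≤-trans -1≤0 0≤1)
    bounded x (inj₂ (x≈1 , _)) = ≤-reflexive x≈1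
    decide : ∃[ s ] ((∀ x → P x → x ≤ s) × (∀ b → (∀ x → P x → x ≤ b) → s ≤ b)) → ¬ Q ⊎ ¬ ¬ Q
    decide (s , upper , least) with ≤-total s 0#
    -- A proof of `Q` puts 1 into `P`, so 1 is at most s; a refutation of `Q` makes -1 an upper
    -- bound, so s is at most -1.
    ... | inj₁ s≤0 = inj₁ λ q → 1≰0 (≤-trans (upper 1# (inj₂ (≈-refl , q))) s≤0)
    ... | inj₂ 0≤s = inj₂ λ ¬q → 1≰0 (≤-resp (solve 0 (:- (:- :1) := :1) ≈-refl) (solve 0 (:- :0 := :0) ≈-refl)
            (neg-mono (≤-trans 0≤s (least (- 1#) λ where
              x (inj₁ x≈-1)    → ≤-reflexive x≈-1
              x (inj₂ (_ , q)) → contradiction q ¬q))))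

  -- Stability turns the second alternative of `weak-excluded-middle` into `Q` itself. Zero tests,
  -- `isBasis?` and `_~?_` all rest on this.
  stable⇒dec : {Q : Set} → (¬ ¬ Q → Q) → Dec Q
  stable⇒dec {Q} stable = [ no , yes ∘ stable ]′ (weak-excluded-middle Q)

  -- {y | ¬ ¬ (y ≈ 0)} is bounded by 1 and closed under adding x, so x ≤ 0.
  ¬¬≈0⇒≤0 : ∀ {x} → ¬ ¬ (x ≈ 0#) → x ≤ 0#
  ¬¬≈0⇒≤0 {x} x≈≈0 = conclude (sup P (0# , λ ¬0≈0 → ¬0≈0 ≈-refl) (1# , bounded))
    where
    P : Carrier → Set
    P y = ¬ ¬ (y ≈ 0#)
    bounded : ∀ y → P y → y ≤ 1#
    bounded y y≈≈0 with ≤-total y 1#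
    ... | inj₁ y≤1 = y≤1
    ... | inj₂ 1≤y = ⊥-elim (y≈≈0 λ y≈0 → 1≰0 (≤-resp ≈-refl y≈0 1≤y))
    shift : ∀ y → P y → P (y + x)
    shift y y≈≈0 ¬z = y≈≈0 λ y≈0 → x≈≈0 λ x≈0 → ¬z (≈-trans (+-cong y≈0 x≈0) (+-identityˡ 0#))
    conclude : ∃[ s ] ((∀ y → P y → y ≤ s) × (∀ b → (∀ y → P y → y ≤ b) → s ≤ b)) → x ≤ 0#
    -- Since y + x is in `P` for every y in `P`, also s + - x is an upper bound; so s is at most s +
    -- - x.
    conclude (s , upper , least) = 0≤y-x⇒x≤y (≤-resp ≈-refl (solve 2 (λ s x → s :+ :- x :+ :- s := :0 :+ :- x) ≈-refl s x)
      (x≤y⇒0≤y-x (least (s + - x) λ y Py → 0≤y-x⇒x≤y (≤-resp ≈-refl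
        (solve 3 (λ s x y → s :+ :- (y :+ x) := s :+ :- x :+ :- y) ≈-refl s x y)
        (x≤y⇒0≤y-x (upper (y + x) (shift y Py)))))))

  -- The previous bound applies to x and to - x alike.
  ≈0-stable : ∀ {x} → ¬ ¬ (x ≈ 0#) → x ≈ 0#
  ≈0-stable {x} x≈≈0 = ≤-antisym (¬¬≈0⇒≤0 x≈≈0)
    (≤-resp ≈-refl (solve 1 (λ x → :- (:- x) := x) ≈-refl x) (0≤-x (¬¬≈0⇒≤0 λ ¬-x → x≈≈0 λ x≈0 →
      ¬-x (≈-trans (-‿cong x≈0) (solve 0 (:- :0 := :0) ≈-refl)))))

  _≟0 : ∀ x → Dec (x ≈ 0#)
  x ≟0 = stable⇒dec ≈0-stable

  x-y≈0⇒x≈y : ∀ {x y} → x + - y ≈ 0# → x ≈ y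
  x-y≈0⇒x≈y {x} {y} h = ≈-trans (solve 2 (λ x y → x := x :+ :- y :+ y) ≈-refl x y)
    (≈-trans (+-congʳ h) (+-identityˡ y))

  x≈y⇒x-y≈0 : ∀ {x y} → x ≈ y → x + - y ≈ 0#
  x≈y⇒x-y≈0 {x} {y} h = ≈-trans (+-congʳ h) (-‿inverseʳ y)

  xy≈0⇒y≈0 : ∀ {x y} → ¬ (x ≈ 0#) → x * y ≈ 0# → y ≈ 0#
  xy≈0⇒y≈0 {x} {y} x≉0 xy≈0 with inverse x x≉0
  ... | z , xz≈1 = begin
    y            ≈⟨ *-identityˡ y ⟨
    1# * y       ≈⟨ *-congʳ xz≈1 ⟨
    x * z * y    ≈⟨ solve 3 (λ x y z → x :* z :* y := z :* (x :* y)) ≈-refl x y z ⟩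
    z * (x * y)  ≈⟨ *-congˡ xy≈0 ⟩
    z * 0#       ≈⟨ zeroʳ z ⟩
    0#           ∎
    where open import Relation.Binary.Reasoning.Setoid setoid

  *-≉0 : ∀ {x y} → ¬ (x ≈ 0#) → ¬ (y ≈ 0#) → ¬ (x * y ≈ 0#)
  *-≉0 x≉0 y≉0 = y≉0 ∘ xy≈0⇒y≈0 x≉0

  sumF-cong : ∀ k {f g : Fin k → Carrier} → (∀ i → f i ≈ g i) → sumF k f ≈ sumF k g
  sumF-cong zero    h = ≈-refl
  sumF-cong (suc k) h = +-cong (h zero) (sumF-cong k (h ∘ suc))

  sumF-linear : ∀ k c (f g : Fin k → Carrier) → sumF k (λ i → c * f i + g i) ≈ c * sumF k f + sumF k g
  sumF-linear zero c f g = solve 1 (λ c → :0 := c :* :0 :+ :0) ≈-refl c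
  sumF-linear (suc k) c f g = ≈-trans (+-congˡ (sumF-linear k c (f ∘ suc) (g ∘ suc)))
    (solve 5 (λ c x y u v → c :* x :+ y :+ (c :* u :+ v) := c :* (x :+ u) :+ (y :+ v)) ≈-refl
      c (f zero) (g zero) (sumF k (f ∘ suc)) (sumF k (g ∘ suc)))

  sumF-0 : ∀ k {f : Fin k → Carrier} → (∀ i → f i ≈ 0#) → sumF k f ≈ 0#
  sumF-0 zero    h = ≈-refl
  sumF-0 (suc k) h = ≈-trans (+-cong (h zero) (sumF-0 k (h ∘ suc))) (+-identityˡ 0#)

  sumF-* : ∀ k c (f : Fin k → Carrier) → sumF k (λ i → c * f i) ≈ c * sumF k f
  sumF-* zero    c f = ≈-sym (zeroʳ c)
  sumF-* (suc k) c f = ≈-trans (+-congˡ (sumF-* k c (f ∘ suc))) (≈-sym (distribˡ c _ _))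

  sumF-swap : ∀ m k (f : Fin m → Fin k → Carrier) →
              sumF m (λ i → sumF k (f i)) ≈ sumF k (λ j → sumF m (λ i → f i j))
  sumF-swap zero    k f = ≈-sym (sumF-0 k λ _ → ≈-refl)
  sumF-swap (suc m) k f = ≈-trans (+-cong (≈-sym (*-identityˡ _)) (sumF-swap m k (f ∘ suc)))
    (≈-trans (≈-sym (sumF-linear k 1# (f zero) _)) (sumF-cong k λ j → +-congʳ (*-identityˡ _)))

  sumF-mono : ∀ k {f g : Fin k → Carrier} → (∀ i → f i ≤ g i) → sumF k f ≤ sumF k g
  sumF-mono zero    h = ≤-refl
  sumF-mono (suc k) h = +-mono₂ (h zero) (sumF-mono k (h ∘ suc))

  sumF-≥0 : ∀ k {f : Fin k → Carrier} → (∀ i → 0# ≤ f i) → 0# ≤ sumF k f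
  sumF-≥0 k h = ≤-resp (sumF-0 k λ _ → ≈-refl) ≈-refl (sumF-mono k h)

  +≈0⇒≈0 : ∀ {x y} → 0# ≤ x → 0# ≤ y → x + y ≈ 0# → x ≈ 0#
  +≈0⇒≈0 {x} {y} 0≤x 0≤y e = ≤-antisym (≤-resp (+-identityʳ x) e (+-mono₂ ≤-refl 0≤y)) 0≤x

  sumF≈0⇒≈0 : ∀ k {f : Fin k → Carrier} → (∀ i → 0# ≤ f i) → sumF k f ≈ 0# → ∀ i → f i ≈ 0#
  sumF≈0⇒≈0 (suc k) h e zero    = +≈0⇒≈0 (h zero) (sumF-≥0 k (h ∘ suc)) e
  sumF≈0⇒≈0 (suc k) h e (suc i) =
    sumF≈0⇒≈0 k (h ∘ suc) (+≈0⇒≈0 (sumF-≥0 k (h ∘ suc)) (h zero) (≈-trans (+-comm _ _) e)) i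

  signed : Bool → Carrier → Carrier
  signed b x = if b then - x else x

  signed-cong : ∀ b {x y} → x ≈ y → signed b x ≈ signed b y
  signed-cong true  = -‿cong
  signed-cong false h = h

  signed-not : ∀ b x → signed (not b) x ≈ - signed b x
  signed-not true  x = solve 1 (λ x → x := :- (:- x)) ≈-refl x
  signed-not false x = ≈-refl

  signed-0 : ∀ b → signed b 0# ≈ 0#
  signed-0 false = ≈-refl
  signed-0 true  = solve 0 (:- :0 := :0) ≈-refl

  -- If every nonzero term had the sign of term i, the sum would be, up to one global sign, a sum of
  -- nonnegative terms, and such a sum vanishes only if each of its terms does.
  opposite-term : ∀ k (s : Fin k → Bool) (m : Fin k → Carrier) → (∀ j → 0# ≤ m j) →
    sumF k (λ j → signed (s j) (m j)) ≈ 0# → ∀ i → ¬ (m i ≈ 0#) →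
    ∃[ j ] (s j ≢ s i × ¬ (m j ≈ 0#))
  opposite-term k s m m≥0 sum≈0 i mi≉0 with Fin.any? compensates?
    where
    compensates? : ∀ j → Dec (s j ≢ s i × ¬ (m j ≈ 0#))
    compensates? j = ¬? (s j Bool.≟ s i) ×-dec ¬? (m j ≟0)
  ... | yes found = found
  ... | no none = contradiction (sumF≈0⇒≈0 k m≥0 (unsign (s i) (≈-trans (≈-sym (sumF-signed k m)) sum′≈0)) i) mi≉0
    where
    sumF-signed : ∀ k (m : Fin k → Carrier) → sumF k (λ j → signed (s i) (m j)) ≈ signed (s i) (sumF k m)
    sumF-signed with s i
    ... | false = λ k m → ≈-refl
    ... | true  = λ k m → ≈-trans (sumF-cong k λ j → solve 1 (λ x → :- x := :- :1 :* x) ≈-refl (m j))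
                    (≈-trans (sumF-* k (- 1#) m) (solve 1 (λ x → :- :1 :* x := :- x) ≈-refl _))
    unsign : ∀ b {x} → signed b x ≈ 0# → x ≈ 0#
    unsign false h = h
    unsign true {x} h = ≈-trans (solve 1 (λ x → x := :- (:- x)) ≈-refl x) (≈-trans (-‿cong h) (solve 0 (:- :0 := :0) ≈-refl))
    -- A term whose sign differs from that of i is zero by `none`, so its sign may be replaced.
    same : ∀ j → signed (s i) (m j) ≈ signed (s j) (m j)
    same j with s j Bool.≟ s i
    ... | yes e = reflexive (cong (λ b → signed b (m j)) (sym e))
    ... | no ¬e with m j ≟0
    ...   | no mj≉0 = contradiction (j , ¬e , mj≉0) none
    ...   | yes mj≈0 = ≈-trans (zeroed (s i)) (≈-sym (zeroed (s j)))
      where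
      zeroed : ∀ b → signed b (m j) ≈ 0#
      zeroed b = ≈-trans (signed-cong b mj≈0) (signed-0 b)
    sum′≈0 : sumF k (λ j → signed (s i) (m j)) ≈ 0#
    sum′≈0 = ≈-trans (sumF-cong k same) sum≈0

-- Insertion, deletion and signs.

ins del : ∀ {n} → Fin n → Subset n → Subset n
ins i B = B [ i ]≔ true
del i B = B [ i ]≔ false

-- The parity of the number of elements of B below j, that is, the sign of moving j to the front of
-- B.
parity : ∀ {n} → Subset n → Fin n → Bool
parity (b ∷ B) zero    = false
parity (b ∷ B) (suc j) = b xor parity B j

length-elems : ∀ {n} (B : Subset n) → List.length (elems B) ≡ ∣ B ∣
length-elems []          = refl
length-elems (true ∷ B)  = cong suc (trans (List.length-map suc (elems B)) (length-elems B))
length-elems (false ∷ B) = trans (List.length-map suc (elems B)) (length-elems B)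

-- Exterior algebra in coordinates and the Plücker relations.

module Exterior (R : CompleteOrderedField) where
  open CompleteOrderedField R hiding (zero) renaming (refl to ≈-refl; sym to ≈-sym; trans to ≈-trans)
  open WithField R
  open OrderedField R
  open IntegerCoefficients commutativeRing using (solve; _:=_; _:+_; _:*_; :-_; :0; :1)

  -- An element of the exterior algebra, of mixed degree, by its coordinates on the products of
  -- basis vectors in increasing order.
  Form : ℕ → Set
  Form n = Subset n → Carrier

  -- The first basis vector is split off. The minus sign comes from moving the rest of a past it; in
  -- dimension zero a is 0 and so is the product.
  wedge : ∀ {n} → (Fin n → Carrier) → Form n → Form n
  wedge a ω []          = 0#
  wedge a ω (false ∷ B) = wedge (a ∘ suc) (ω ∘ (false ∷_)) B
  wedge a ω (true ∷ B)  = a zero * ω (false ∷ B) + - wedge (a ∘ suc) (ω ∘ (true ∷_)) B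

  -- Contraction with the j-th basis covector.
  ι : ∀ {n} → Fin n → Form n → Form n
  ι zero    ω (false ∷ B) = ω (true ∷ B)
  ι zero    ω (true ∷ B)  = 0#
  ι (suc j) ω (false ∷ B) = ι j (ω ∘ (false ∷_)) B
  ι (suc j) ω (true ∷ B)  = - ι j (ω ∘ (true ∷_)) B

  𝟙 : ∀ {n} → Form n
  𝟙 []          = 1#
  𝟙 (false ∷ B) = 𝟙 B
  𝟙 (true ∷ B)  = 0#

  vol : ∀ {n} d → (Fin d → Fin n → Carrier) → Form n
  vol zero    M = 𝟙
  vol (suc d) M = wedge (M zero) (vol d (M ∘ suc))

  wedge-cong : ∀ {n} {a b : Fin n → Carrier} {ω η : Form n} →
               (∀ j → a j ≈ b j) → (∀ B → ω B ≈ η B) → ∀ B → wedge a ω B ≈ wedge b η B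
  wedge-cong a≈b ω≈η []          = ≈-refl
  wedge-cong a≈b ω≈η (false ∷ B) = wedge-cong (a≈b ∘ suc) (ω≈η ∘ (false ∷_)) B
  wedge-cong a≈b ω≈η (true ∷ B)  = +-cong (*-cong (a≈b zero) (ω≈η (false ∷ B)))
    (-‿cong (wedge-cong (a≈b ∘ suc) (ω≈η ∘ (true ∷_)) B))

  -- The combination c ω - η is the one that `wedge` itself produces at `true ∷ B`, so this form of
  -- linearity serves the inductions on products directly.
  wedge-linearʳ : ∀ {n} (a : Fin n → Carrier) c (ω η : Form n) B →
                  wedge a (λ K → c * ω K + - η K) B ≈ c * wedge a ω B + - wedge a η B
  wedge-linearʳ a c ω η []          = solve 1 (λ c → :0 := c :* :0 :+ :- :0) ≈-refl c
  wedge-linearʳ a c ω η (false ∷ B) = wedge-linearʳ (a ∘ suc) c (ω ∘ (false ∷_)) (η ∘ (false ∷_)) B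
  wedge-linearʳ a c ω η (true ∷ B)  = ≈-trans
    (+-congˡ (-‿cong (wedge-linearʳ (a ∘ suc) c (ω ∘ (true ∷_)) (η ∘ (true ∷_)) B)))
    (solve 6 (λ a c x y u v → a :* (c :* x :+ :- y) :+ :- (c :* u :+ :- v)
                := c :* (a :* x :+ :- u) :+ :- (a :* y :+ :- v)) ≈-refl
      (a zero) c (ω (false ∷ B)) (η (false ∷ B)) _ _)

  wedge-linearˡ : ∀ {n} (a b : Fin n → Carrier) c (ω : Form n) B →
                  wedge (λ j → c * a j + - b j) ω B ≈ c * wedge a ω B + - wedge b ω B
  wedge-linearˡ a b c ω []          = solve 1 (λ c → :0 := c :* :0 :+ :- :0) ≈-refl c
  wedge-linearˡ a b c ω (false ∷ B) = wedge-linearˡ (a ∘ suc) (b ∘ suc) c (ω ∘ (false ∷_)) B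
  wedge-linearˡ a b c ω (true ∷ B)  = ≈-trans
    (+-congˡ (-‿cong (wedge-linearˡ (a ∘ suc) (b ∘ suc) c (ω ∘ (true ∷_)) B)))
    (solve 6 (λ a b c x u v → (c :* a :+ :- b) :* x :+ :- (c :* u :+ :- v)
                := c :* (a :* x :+ :- u) :+ :- (b :* x :+ :- v)) ≈-refl
      (a zero) (b zero) c (ω (false ∷ B)) _ _)

  wedge-0ʳ : ∀ {n} (a : Fin n → Carrier) {ω : Form n} → (∀ K → ω K ≈ 0#) → ∀ B → wedge a ω B ≈ 0#
  wedge-0ʳ a ω≈0 []          = ≈-refl
  wedge-0ʳ a ω≈0 (false ∷ B) = wedge-0ʳ (a ∘ suc) (ω≈0 ∘ (false ∷_)) B
  wedge-0ʳ a ω≈0 (true ∷ B)  = ≈-trans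
    (+-cong (*-congˡ (ω≈0 (false ∷ B))) (-‿cong (wedge-0ʳ (a ∘ suc) (ω≈0 ∘ (true ∷_)) B)))
    (solve 1 (λ a → a :* :0 :+ :- :0 := :0) ≈-refl (a zero))

  wedge-0ˡ : ∀ {n} {a : Fin n → Carrier} (ω : Form n) → (∀ j → a j ≈ 0#) → ∀ B → wedge a ω B ≈ 0#
  wedge-0ˡ ω a≈0 []          = ≈-refl
  wedge-0ˡ ω a≈0 (false ∷ B) = wedge-0ˡ (ω ∘ (false ∷_)) (a≈0 ∘ suc) B
  wedge-0ˡ ω a≈0 (true ∷ B)  = ≈-trans
    (+-cong (*-congʳ (a≈0 zero)) (-‿cong (wedge-0ˡ (ω ∘ (true ∷_)) (a≈0 ∘ suc) B)))
    (solve 1 (λ a → :0 :* a :+ :- :0 := :0) ≈-refl (ω (false ∷ B)))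

  wedge-neg : ∀ {n} (a : Fin n → Carrier) (ω : Form n) B → wedge a (λ K → - ω K) B ≈ - wedge a ω B
  wedge-neg a ω B = ≈-trans
    (wedge-cong (λ _ → ≈-refl) (λ K → solve 1 (λ x → :- x := :0 :* x :+ :- x) ≈-refl (ω K)) B)
    (≈-trans (wedge-linearʳ a 0# ω ω B) (solve 1 (λ x → :0 :* x :+ :- x := :- x) ≈-refl (wedge a ω B)))

  wedge-self : ∀ {n} (a : Fin n → Carrier) (ω : Form n) B → wedge a (wedge a ω) B ≈ 0#
  wedge-self a ω []          = ≈-refl
  wedge-self a ω (false ∷ B) = wedge-self (a ∘ suc) (ω ∘ (false ∷_)) B
  wedge-self a ω (true ∷ B)  = ≈-trans
    (+-congˡ (-‿cong (≈-trans (wedge-linearʳ (a ∘ suc) (a zero) _ _ B)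
      (+-congˡ (-‿cong (wedge-self (a ∘ suc) (ω ∘ (true ∷_)) B))))))
    (solve 1 (λ x → x :+ :- (x :+ :- :0) := :0) ≈-refl _)

  wedge-anticomm : ∀ {n} (a b : Fin n → Carrier) (ω : Form n) B →
                   wedge a (wedge b ω) B ≈ - wedge b (wedge a ω) B
  wedge-anticomm a b ω []          = solve 0 (:0 := :- :0) ≈-refl
  wedge-anticomm a b ω (false ∷ B) = wedge-anticomm (a ∘ suc) (b ∘ suc) (ω ∘ (false ∷_)) B
  wedge-anticomm a b ω (true ∷ B)  = ≈-trans
    (+-congˡ (-‿cong (≈-trans (wedge-linearʳ (a ∘ suc) (b zero) _ _ B)
      (+-congˡ (-‿cong (wedge-anticomm (a ∘ suc) (b ∘ suc) (ω ∘ (true ∷_)) B))))))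
    (≈-trans (solve 3 (λ x y z → x :+ :- (y :+ :- (:- z)) := :- (y :+ :- (x :+ :- z))) ≈-refl _ _ _)
      (-‿cong (+-congˡ (-‿cong (≈-sym (wedge-linearʳ (b ∘ suc) (a zero) _ _ B))))))

  ι-linear : ∀ {n} j c (ω η : Form n) B → ι j (λ K → c * ω K + - η K) B ≈ c * ι j ω B + - ι j η B
  ι-linear zero    c ω η (false ∷ B) = ≈-refl
  ι-linear zero    c ω η (true ∷ B)  = solve 1 (λ c → :0 := c :* :0 :+ :- :0) ≈-refl c
  ι-linear (suc j) c ω η (false ∷ B) = ι-linear j c (ω ∘ (false ∷_)) (η ∘ (false ∷_)) B
  ι-linear (suc j) c ω η (true ∷ B)  = ≈-trans
    (-‿cong (ι-linear j c (ω ∘ (true ∷_)) (η ∘ (true ∷_)) B))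
    (solve 3 (λ c x y → :- (c :* x :+ :- y) := c :* :- x :+ :- (:- y)) ≈-refl c _ _)

  -- Contraction is an antiderivation, and it sends the vector a to its j-th coordinate.
  ι-wedge : ∀ {n} j (a : Fin n → Carrier) (ω : Form n) B →
            ι j (wedge a ω) B ≈ ω B * a j + - wedge a (ι j ω) B
  ι-wedge zero a ω (false ∷ B) = +-congʳ (*-comm _ _)
  ι-wedge zero a ω (true ∷ B)  = ≈-trans (solve 2 (λ x y → :0 := x :* y :+ :- (y :* x :+ :- :0)) ≈-refl _ _)
    (+-congˡ (-‿cong (+-congˡ (-‿cong (≈-sym (wedge-0ʳ (a ∘ suc) (λ _ → ≈-refl) B))))))
  ι-wedge (suc j) a ω (false ∷ B) = ι-wedge j (a ∘ suc) (ω ∘ (false ∷_)) B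
  ι-wedge (suc j) a ω (true ∷ B)  = begin
    - ι j (λ K → a zero * ω (false ∷ K) + - wedge (a ∘ suc) (ω ∘ (true ∷_)) K) B
      ≈⟨ -‿cong (≈-trans (ι-linear j (a zero) _ _ B) (+-congˡ (-‿cong (ι-wedge j (a ∘ suc) (ω ∘ (true ∷_)) B)))) ⟩
    - (x + - (y + - z))
      ≈⟨ solve 3 (λ x y z → :- (x :+ :- (y :+ :- z)) := y :+ :- (x :+ :- (:- z))) ≈-refl x y z ⟩
    y + - (x + - (- z))
      ≈⟨ +-congˡ (-‿cong (+-congˡ (-‿cong (wedge-neg (a ∘ suc) (ι j (ω ∘ (true ∷_))) B)))) ⟨
    y + - (x + - wedge (a ∘ suc) (λ K → - ι j (ω ∘ (true ∷_)) K) B) ∎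
    where
    open import Relation.Binary.Reasoning.Setoid setoid
    x = a zero * ι j (ω ∘ (false ∷_)) B
    y = ω (true ∷ B) * a (suc j)
    z = wedge (a ∘ suc) (ι j (ω ∘ (true ∷_))) B

  ι-𝟙 : ∀ {n} j (B : Subset n) → ι j 𝟙 B ≈ 0#
  ι-𝟙 zero    (false ∷ B) = ≈-refl
  ι-𝟙 zero    (true ∷ B)  = ≈-refl
  ι-𝟙 (suc j) (false ∷ B) = ι-𝟙 j B
  ι-𝟙 (suc j) (true ∷ B)  = ≈-trans (-‿cong (ι-0 j B)) (solve 0 (:- :0 := :0) ≈-refl)
    where
    ι-0 : ∀ {n} j (B : Subset n) → ι j (λ _ → 0#) B ≈ 0#
    ι-0 zero    (false ∷ B) = ≈-refl
    ι-0 zero    (true ∷ B)  = ≈-refl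
    ι-0 (suc j) (false ∷ B) = ι-0 j B
    ι-0 (suc j) (true ∷ B)  = ≈-trans (-‿cong (ι-0 j B)) (solve 0 (:- :0 := :0) ≈-refl)

  -- Both sides apply two linear operators to the array f, one acting on its set argument and one on
  -- its index j; operators on different arguments commute.
  wedge-exchange : ∀ {m n} (a : Fin m → Carrier) (f : Fin n → Form m) (ω : Form n) I J →
    wedge (λ j → wedge a (f j) I) ω J ≈ wedge a (λ K → wedge (λ j → f j K) ω J) I
  wedge-exchange a f ω []          J = wedge-0ˡ ω (λ _ → ≈-refl) J
  wedge-exchange a f ω (false ∷ I) J = wedge-exchange (a ∘ suc) (λ j → f j ∘ (false ∷_)) ω I J
  wedge-exchange a f ω (true ∷ I)  J = ≈-trans
    (wedge-linearˡ (λ j → f j (false ∷ I)) _ (a zero) ω J)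
    (+-congˡ (-‿cong (wedge-exchange (a ∘ suc) (λ j → f j ∘ (true ∷_)) ω I J)))

  -- The contractions of a decomposable form ω lie in the span of its factors, so wedging
  -- them with ω gives zero; these are the Plücker relations.
  plücker : ∀ {n} d (M : Fin d → Fin n → Carrier) I J → wedge (λ j → ι j (vol d M) I) (vol d M) J ≈ 0#
  plücker zero    M I J = wedge-0ˡ 𝟙 (λ j → ι-𝟙 j I) J
  plücker (suc d) M I J = begin
    wedge (λ j → ι j (wedge a η) I) (wedge a η) J
      ≈⟨ wedge-cong (λ j → ι-wedge j a η I) (λ _ → ≈-refl) J ⟩
    wedge (λ j → η I * a j + - wedge a (ι j η) I) (wedge a η) J
      ≈⟨ wedge-linearˡ a _ (η I) (wedge a η) J ⟩
    η I * wedge a (wedge a η) J + - wedge (λ j → wedge a (ι j η) I) (wedge a η) J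
      ≈⟨ +-cong (*-congˡ (wedge-self a η J)) (-‿cong (≈-trans (wedge-exchange a (λ j → ι j η) (wedge a η) I J)
           (wedge-0ʳ a inner I))) ⟩
    η I * 0# + - 0#
      ≈⟨ solve 1 (λ x → x :* :0 :+ :- :0 := :0) ≈-refl (η I) ⟩
    0# ∎
    where
    open import Relation.Binary.Reasoning.Setoid setoid
    a = M zero
    η = vol d (M ∘ suc)
    -- Anticommuting moves a to the outside and leaves a Plücker expression of the remaining rows,
    -- zero by induction.
    inner : ∀ K → wedge (λ j → ι j η K) (wedge a η) J ≈ 0#
    inner K = ≈-trans (wedge-anticomm _ a η J)
      (≈-trans (-‿cong (wedge-0ʳ a (plücker d (M ∘ suc) K) J)) (solve 0 (:- :0 := :0) ≈-refl))

  -- Laplace expansion along the factor v.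
  wedge-sum : ∀ {n} (v : Fin n → Carrier) (ω : Form n) B →
    wedge v ω B ≈ sumF n (λ j → if B ! j then signed (parity B j) (v j * ω (del j B)) else 0#)
  wedge-sum v ω [] = ≈-refl
  wedge-sum v ω (false ∷ B) = ≈-trans (wedge-sum (v ∘ suc) (ω ∘ (false ∷_)) B) (≈-sym (+-identityˡ _))
  wedge-sum {suc n} v ω (true ∷ B) = +-congˡ (≈-trans (-‿cong (wedge-sum (v ∘ suc) (ω ∘ (true ∷_)) B))
    (≈-trans (solve 1 (λ x → :- x := :- :1 :* x) ≈-refl _)
      (≈-trans (≈-sym (sumF-* n (- 1#) _)) (sumF-cong n step))))
    where
    step : ∀ j → - 1# * (if B ! j then signed (parity B j) (v (suc j) * ω (true ∷ del j B)) else 0#)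
                 ≈ (if B ! j then signed (not (parity B j)) (v (suc j) * ω (true ∷ del j B)) else 0#)
    step j with B ! j
    ... | true  = ≈-trans (solve 1 (λ x → :- :1 :* x := :- x) ≈-refl _) (≈-sym (signed-not (parity B j) _))
    ... | false = zeroʳ _

  ι-∉ : ∀ {n} j (ω : Form n) B → B ! j ≡ false → ι j ω B ≈ signed (parity B j) (ω (ins j B))
  ι-∉ zero    ω (false ∷ B) _   = ≈-refl
  ι-∉ (suc j) ω (false ∷ B) j∉B = ι-∉ j (ω ∘ (false ∷_)) B j∉B
  ι-∉ (suc j) ω (true ∷ B)  j∉B = ≈-trans (-‿cong (ι-∉ j (ω ∘ (true ∷_)) B j∉B)) (≈-sym (signed-not (parity B j) _))

  ι-∈ : ∀ {n} j (ω : Form n) B → B ! j ≡ true → ι j ω B ≈ 0#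
  ι-∈ zero    ω (true ∷ B)  _   = ≈-refl
  ι-∈ (suc j) ω (false ∷ B) j∈B = ι-∈ j (ω ∘ (false ∷_)) B j∈B
  ι-∈ (suc j) ω (true ∷ B)  j∈B = ≈-trans (-‿cong (ι-∈ j (ω ∘ (true ∷_)) B j∈B)) (solve 0 (:- :0 := :0) ≈-refl)

  -- The default 0 at indices outside J - I lets the Plücker sum run over all of `Fin n`.
  exchangeTerm : ∀ {n} → Form n → Subset n → Subset n → Fin n → Carrier
  exchangeTerm ω I J j = if not (I ! j) ∧ J ! j then ω (ins j I) * ω (del j J) else 0#

  -- Of the two parities, that of I is the sign of the contraction and that of J the sign of the
  -- Laplace expansion.
  plücker-sum : ∀ {n} d (M : Fin d → Fin n → Carrier) I J →
    sumF n (λ j → signed (parity I j xor parity J j) (exchangeTerm (vol d M) I J j)) ≈ 0#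
  plücker-sum {n} d M I J = ≈-trans (sumF-cong n step) (≈-trans (≈-sym (wedge-sum _ ω J)) (plücker d M I J))
    where
    ω = vol d M
    signs : ∀ b c x y → signed (b xor c) (x * y) ≈ signed c (signed b x * y)
    signs false c     x y = ≈-refl
    signs true  true  x y = solve 2 (λ x y → x :* y := :- (:- x :* y)) ≈-refl x y
    signs true  false x y = solve 2 (λ x y → :- (x :* y) := :- x :* y) ≈-refl x y
    step : ∀ j → signed (parity I j xor parity J j) (exchangeTerm ω I J j)
                 ≈ (if J ! j then signed (parity J j) (ι j ω I * ω (del j J)) else 0#)
    step j with I ! j in Ij | J ! j
    ... | true  | true  = ≈-trans (signed-0 (parity I j xor parity J j)) (≈-sym (≈-trans (signed-cong (parity J j)
                            (≈-trans (*-congʳ (ι-∈ j ω I Ij)) (zeroˡ _))) (signed-0 (parity J j))))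
    ... | true  | false = signed-0 (parity I j xor parity J j)
    ... | false | false = signed-0 (parity I j xor parity J j)
    ... | false | true  = ≈-trans (signs (parity I j) (parity J j) _ _)
                            (signed-cong (parity J j) (*-congʳ (≈-sym (ι-∉ j ω I Ij))))

  -- wedgeL and volL transport wedge and vol to lists of columns, the form in which
  -- minor selects its submatrix.
  wedgeL : {X : Set} → (X → Carrier) → (List X → Carrier) → List X → Carrier
  wedgeL a f []       = 0#
  wedgeL a f (x ∷ xs) = a x * f xs + - wedgeL a (f ∘ (x ∷_)) xs

  wedgeL-cong : {X : Set} (a : X → Carrier) {f g : List X → Carrier} → (∀ xs → f xs ≈ g xs) →
                ∀ xs → wedgeL a f xs ≈ wedgeL a g xs
  wedgeL-cong a f≈g []       = ≈-refl
  wedgeL-cong a f≈g (x ∷ xs) = +-cong (*-congˡ (f≈g xs)) (-‿cong (wedgeL-cong a (f≈g ∘ (x ∷_)) xs))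

  wedgeL-map : {X Y : Set} (h : X → Y) (a : Y → Carrier) (f : List Y → Carrier) →
               ∀ xs → wedgeL a f (List.map h xs) ≈ wedgeL (a ∘ h) (f ∘ List.map h) xs
  wedgeL-map h a f []       = ≈-refl
  wedgeL-map h a f (x ∷ xs) = +-congˡ (-‿cong (wedgeL-map h a (f ∘ (h x ∷_)) xs))

  wedgeL-elems : ∀ {n} (a : Fin n → Carrier) (f : List (Fin n) → Carrier) B →
                 wedgeL a f (elems B) ≈ wedge a (f ∘ elems) B
  wedgeL-elems a f []          = ≈-refl
  wedgeL-elems a f (false ∷ B) = ≈-trans (wedgeL-map suc a f (elems B))
    (wedgeL-elems (a ∘ suc) (f ∘ List.map suc) B)
  wedgeL-elems a f (true ∷ B)  = +-congˡ (-‿cong (≈-trans (wedgeL-map suc a (f ∘ (zero ∷_)) (elems B))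
    (wedgeL-elems (a ∘ suc) (f ∘ (zero ∷_) ∘ List.map suc) B)))

  volL : ∀ {n} d → (Fin d → Fin n → Carrier) → List (Fin n) → Carrier
  volL zero    M []      = 1#
  volL zero    M (_ ∷ _) = 0#
  volL (suc d) M xs      = wedgeL (M zero) (volL d (M ∘ suc)) xs

  vol≈volL : ∀ {n} d (M : Fin d → Fin n → Carrier) B → vol d M B ≈ volL d M (elems B)
  vol≈volL zero M [] = ≈-refl
  vol≈volL zero M (false ∷ B) = ≈-trans (vol≈volL zero (λ r c → M r (suc c)) B) (volL-map (elems B))
    where
    volL-map : ∀ xs → volL 0 (λ r c → M r (suc c)) xs ≈ volL 0 M (List.map suc xs)
    volL-map []       = ≈-refl
    volL-map (x ∷ xs) = ≈-refl
  vol≈volL zero M (true ∷ B) = ≈-refl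
  vol≈volL (suc d) M B = ≈-trans (wedge-cong (λ _ → ≈-refl) (vol≈volL d (M ∘ suc)) B)
    (≈-sym (wedgeL-elems (M zero) (volL d (M ∘ suc)) B))

  -- Unrolling `wedgeL` is cofactor expansion: the column at position p is taken out, and each
  -- column passed on the way contributes a minus sign.
  wedgeL-tabulate : ∀ {X : Set} k (a : X → Carrier) (f : List X → Carrier) (g : Fin (suc k) → X) →
    wedgeL a f (List.tabulate g) ≈
    sumF (suc k) (λ p → alt (Fin.toℕ p) * a (g p) * f (List.tabulate (g ∘ punchIn p)))
  wedgeL-tabulate zero a f g = solve 2 (λ x y → x :* y :+ :- :0 := :1 :* x :* y :+ :0) ≈-refl _ _
  wedgeL-tabulate (suc k) a f g = +-cong (*-congʳ (≈-sym (*-identityˡ _)))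
    (≈-trans (-‿cong (wedgeL-tabulate k a (f ∘ (g zero ∷_)) (g ∘ suc)))
      (≈-trans (solve 1 (λ x → :- x := :- :1 :* x) ≈-refl _)
        (≈-trans (≈-sym (sumF-* (suc k) (- 1#) (λ p → alt (Fin.toℕ p) * a (g (suc p)) * f (g zero ∷ List.tabulate (g ∘ suc ∘ punchIn p)))))
          (sumF-cong (suc k) λ p → solve 3 (λ x y z → :- :1 :* (x :* y :* z) := :- x :* y :* z) ≈-refl
            (alt (Fin.toℕ p)) (a (g (suc p))) (f (g zero ∷ List.tabulate (g ∘ suc ∘ punchIn p)))))))

  det≈volL : ∀ {n} d (M : Fin d → Fin n → Carrier) (g : Fin d → Fin n) →
             det d (λ r c → M r (g c)) ≈ volL d M (List.tabulate g)
  det≈volL zero    M g = ≈-refl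
  det≈volL (suc d) M g = ≈-trans
    (sumF-cong (suc d) λ p → *-congˡ {x = alt (Fin.toℕ p) * M zero (g p)} (det≈volL d (M ∘ suc) (g ∘ punchIn p)))
    (≈-sym (wedgeL-tabulate d (M zero) (volL d (M ∘ suc)) g))

  minor≈vol : ∀ {d n} (A : Fin d → Fin n → Carrier) B → ∣ B ∣ ≡ d → minor A B ≈ vol d A B
  minor≈vol {d} A B ∣B∣≡d with d ℕ.≟ List.length (elems B)
  -- `elems B` has d entries, so the default value of `minor` does not occur.
  ... | no d≢ = contradiction (trans (sym ∣B∣≡d) (sym (length-elems B))) d≢
  ... | yes eq = ≈-trans (det≈volL d A _)
    (≈-trans (reflexive (cong (volL d A) (tabulate-cast (elems B) eq))) (≈-sym (vol≈volL d A B)))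
    where
    tabulate-cast : ∀ {X : Set} {k} (xs : List X) (eq : k ≡ List.length xs) →
                    List.tabulate (λ c → List.lookup xs (cast eq c)) ≡ xs
    tabulate-cast xs refl = trans
      (List.tabulate-cong λ c → cong (List.lookup xs) (Fin.cast-is-id refl c))
      (List.tabulate-lookup xs)

-- Subsets: updates, cardinalities and splicing.

true≢false : ∀ {b} → b ≡ true → b ≡ false → ⊥
true≢false refl ()

≢true⇒false : ∀ {b} → (b ≡ true → ⊥) → b ≡ false
≢true⇒false {true}  h = ⊥-elim (h refl)
≢true⇒false {false} h = refl

!-ins : ∀ {n} i (B : Subset n) → ins i B ! i ≡ true
!-ins i B = Vec.lookup∘update i B true

!-del : ∀ {n} i (B : Subset n) → del i B ! i ≡ false
!-del i B = Vec.lookup∘update i B false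

!-upd : ∀ {n} {i k} (B : Subset n) {b} → k ≢ i → (B [ i ]≔ b) ! k ≡ B ! k
!-upd B {b} k≢i = Vec.lookup∘update′ k≢i B b

ins-del : ∀ {n} i (B : Subset n) → B ! i ≡ true → ins i (del i B) ≡ B
ins-del i B i∈B = trans (Vec.[]≔-idempotent B i) (trans (cong (B [ i ]≔_) (sym i∈B)) (Vec.[]≔-lookup B i))

del-ins : ∀ {n} i (B : Subset n) → B ! i ≡ false → del i (ins i B) ≡ B
del-ins i B i∉B = trans (Vec.[]≔-idempotent B i) (trans (cong (B [ i ]≔_) (sym i∉B)) (Vec.[]≔-lookup B i))

upd-comm : ∀ {n} {i j} (B : Subset n) {b c} → i ≢ j → ((B [ i ]≔ b) [ j ]≔ c) ≡ ((B [ j ]≔ c) [ i ]≔ b)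
upd-comm {i = i} {j} B i≢j = Vec.[]≔-commutes B i j i≢j

∈-upd⁻ : ∀ {n} {i k} (B : Subset n) → ins i B ! k ≡ true → k ≡ i ⊎ B ! k ≡ true
∈-upd⁻ {i = i} {k} B h with k Fin.≟ i
... | yes e = inj₁ e
... | no ¬e = inj₂ (trans (sym (!-upd B ¬e)) h)

∉-ins⁻ : ∀ {n} {i k} (B : Subset n) → ins i B ! k ≡ false → k ≢ i × B ! k ≡ false
∉-ins⁻ {i = i} {k} B h with k Fin.≟ i
... | yes refl = ⊥-elim (true≢false (!-ins i B) h)
... | no ¬e = ¬e , trans (sym (!-upd B ¬e)) h

∣ins∣ : ∀ {n} i (B : Subset n) → B ! i ≡ false → ∣ ins i B ∣ ≡ suc ∣ B ∣
∣ins∣ zero    (false ∷ B) _ = refl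
∣ins∣ (suc i) (false ∷ B) h = ∣ins∣ i B h
∣ins∣ (suc i) (true ∷ B)  h = cong suc (∣ins∣ i B h)

∣del∣ : ∀ {n} i (B : Subset n) → B ! i ≡ true → suc ∣ del i B ∣ ≡ ∣ B ∣
∣del∣ i B i∈B = trans (sym (∣ins∣ i (del i B) (!-del i B))) (cong ∣_∣ (ins-del i B i∈B))

parity-ins-< : ∀ {n} {k j} (B : Subset n) → B ! k ≡ false → k < j → parity (ins k B) j ≡ not (parity B j)
parity-ins-< {k = zero}  {suc j} (false ∷ B) _ _ = refl
parity-ins-< {k = suc k} {suc j} (b ∷ B) h (ℕ.s≤s k<j) =
  trans (cong (b xor_) (parity-ins-< B h k<j)) (sym (Bool.not-distribʳ-xor b (parity B j)))

parity-ins-≮ : ∀ {n} {k j} (B : Subset n) → ¬ k < j → parity (ins k B) j ≡ parity B j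
parity-ins-≮ {k = zero}  {zero}  (b ∷ B) _ = refl
parity-ins-≮ {k = zero}  {suc j} (b ∷ B) h = ⊥-elim (h (ℕ.s≤s ℕ.z≤n))
parity-ins-≮ {k = suc k} {zero}  (b ∷ B) h = refl
parity-ins-≮ {k = suc k} {suc j} (b ∷ B) h = cong (b xor_) (parity-ins-≮ B (h ∘ ℕ.s≤s))

setOf : ∀ {n} {U : Fin n → Set} → (∀ x → Dec (U x)) → Subset n
setOf U? = Vec.tabulate (does ∘ U?)

∈setOf⁺ : ∀ {n} {U : Fin n → Set} (U? : ∀ x → Dec (U x)) {x} → U x → setOf U? ! x ≡ true
∈setOf⁺ U? {x} Ux = trans (Vec.lookup∘tabulate (does ∘ U?) x) (dec-true (U? x) Ux)

∈setOf⁻ : ∀ {n} {U : Fin n → Set} (U? : ∀ x → Dec (U x)) {x} → setOf U? ! x ≡ true → U x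
∈setOf⁻ U? {x} h with U? x | trans (sym (Vec.lookup∘tabulate (does ∘ U?) x)) h
... | yes Ux | _ = Ux

-- Combines two bases along P. When P is a separator the result is a basis again, since the matroid
-- is then a direct sum.
splice : ∀ {n} → Subset n → Subset n → Subset n → Subset n
splice []      []      []        = []
splice (p ∷ P) (x ∷ B) (y ∷ B′) = (if p then x else y) ∷ splice P B B′

!-splice-∈ : ∀ {n} (P B B′ : Subset n) {k} → P ! k ≡ true → splice P B B′ ! k ≡ B ! k
!-splice-∈ (true ∷ P) (x ∷ B) (y ∷ B′) {zero}  h = refl
!-splice-∈ (p ∷ P)    (x ∷ B) (y ∷ B′) {suc k} h = !-splice-∈ P B B′ h

!-splice-∉ : ∀ {n} (P B B′ : Subset n) {k} → P ! k ≡ false → splice P B B′ ! k ≡ B′ ! k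
!-splice-∉ (false ∷ P) (x ∷ B) (y ∷ B′) {zero}  h = refl
!-splice-∉ (p ∷ P)     (x ∷ B) (y ∷ B′) {suc k} h = !-splice-∉ P B B′ h

splice-updˡ : ∀ {n} (P B B′ : Subset n) k {b} → P ! k ≡ true → splice P (B [ k ]≔ b) B′ ≡ (splice P B B′ [ k ]≔ b)
splice-updˡ (true ∷ P) (x ∷ B) (y ∷ B′) zero    h = refl
splice-updˡ (p ∷ P)    (x ∷ B) (y ∷ B′) (suc k) h = cong (_ ∷_) (splice-updˡ P B B′ k h)

splice-updʳ : ∀ {n} (P B B′ : Subset n) k {b} → P ! k ≡ false → splice P B (B′ [ k ]≔ b) ≡ (splice P B B′ [ k ]≔ b)
splice-updʳ (false ∷ P) (x ∷ B) (y ∷ B′) zero    h = refl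
splice-updʳ (p ∷ P)     (x ∷ B) (y ∷ B′) (suc k) h = cong (_ ∷_) (splice-updʳ P B B′ k h)

splice-upd-∉ : ∀ {n} (P B B′ : Subset n) k {b} → P ! k ≡ false → splice P (B [ k ]≔ b) B′ ≡ splice P B B′
splice-upd-∉ (false ∷ P) (x ∷ B) (y ∷ B′) zero    h = refl
splice-upd-∉ (p ∷ P)     (x ∷ B) (y ∷ B′) (suc k) h = cong (_ ∷_) (splice-upd-∉ P B B′ k h)

splice-≡ˡ : ∀ {n} (P B B′ : Subset n) → (∀ k → P ! k ≡ false → B ! k ≡ B′ ! k) → splice P B B′ ≡ B
splice-≡ˡ []          []      []       h = refl
splice-≡ˡ (true ∷ P)  (x ∷ B) (y ∷ B′) h = cong (x ∷_) (splice-≡ˡ P B B′ (h ∘ suc))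
splice-≡ˡ (false ∷ P) (x ∷ B) (y ∷ B′) h = cong₂ _∷_ (sym (h zero refl)) (splice-≡ˡ P B B′ (h ∘ suc))

∣∩∣+∣∩∁∣ : ∀ {n} (B P : Subset n) → ∣ B ∩ P ∣ ℕ.+ ∣ B ∩ ∁ P ∣ ≡ ∣ B ∣
∣∩∣+∣∩∁∣ []          []          = refl
∣∩∣+∣∩∁∣ (false ∷ B) (_ ∷ P)     = ∣∩∣+∣∩∁∣ B P
∣∩∣+∣∩∁∣ (true ∷ B)  (true ∷ P)  = cong suc (∣∩∣+∣∩∁∣ B P)
∣∩∣+∣∩∁∣ (true ∷ B)  (false ∷ P) = trans (ℕ.+-suc _ _) (cong suc (∣∩∣+∣∩∁∣ B P))

∣splice∣ : ∀ {n} (P B B′ : Subset n) → ∣ splice P B B′ ∣ ≡ ∣ B ∩ P ∣ ℕ.+ ∣ B′ ∩ ∁ P ∣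
∣splice∣ []          []          []           = refl
∣splice∣ (true ∷ P)  (true ∷ B)  (true ∷ B′)  = cong suc (∣splice∣ P B B′)
∣splice∣ (true ∷ P)  (true ∷ B)  (false ∷ B′) = cong suc (∣splice∣ P B B′)
∣splice∣ (true ∷ P)  (false ∷ B) (true ∷ B′)  = ∣splice∣ P B B′
∣splice∣ (true ∷ P)  (false ∷ B) (false ∷ B′) = ∣splice∣ P B B′
∣splice∣ (false ∷ P) (true ∷ B)  (true ∷ B′)  = trans (cong suc (∣splice∣ P B B′)) (sym (ℕ.+-suc _ _))
∣splice∣ (false ∷ P) (true ∷ B)  (false ∷ B′) = ∣splice∣ P B B′
∣splice∣ (false ∷ P) (false ∷ B) (true ∷ B′)  = trans (cong suc (∣splice∣ P B B′)) (sym (ℕ.+-suc _ _))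
∣splice∣ (false ∷ P) (false ∷ B) (false ∷ B′) = ∣splice∣ P B B′

-- The measure for exchanging B into B′ off P: the element leaving B lowers it by one, and the
-- entering element of B′ does not count.
excess : ∀ {n} → Subset n → Subset n → Subset n → ℕ
excess []      []      []       = 0
excess (p ∷ P) (x ∷ B) (y ∷ B′) = (if not p ∧ x ∧ not y then 1 else 0) ℕ.+ excess P B B′

excess-ins : ∀ {n} (P B B′ : Subset n) j → B′ ! j ≡ true → excess P (ins j B) B′ ≡ excess P B B′
excess-ins (true ∷ P)  (x ∷ B)     (true ∷ B′) zero h = refl
excess-ins (false ∷ P) (true ∷ B)  (true ∷ B′) zero h = refl
excess-ins (false ∷ P) (false ∷ B) (true ∷ B′) zero h = refl
excess-ins (p ∷ P) (x ∷ B) (y ∷ B′) (suc j) h = cong (_ ℕ.+_) (excess-ins P B B′ j h)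

excess-del : ∀ {n} (P B B′ : Subset n) i → P ! i ≡ false → B ! i ≡ true → B′ ! i ≡ false →
             suc (excess P (del i B) B′) ≡ excess P B B′
excess-del (false ∷ P) (true ∷ B) (false ∷ B′) zero    _ _ _ = refl
excess-del (p ∷ P)     (x ∷ B)    (y ∷ B′)     (suc i) f g h =
  trans (sym (ℕ.+-suc _ _)) (cong (_ ℕ.+_) (excess-del P B B′ i f g h))

-- Signed exchange and connected components.

sign : ∀ {n} → Subset n → Subset n → Fin n → Bool
sign I J j = parity I j xor parity J j

-- The exchange property that nonnegativity extracts from the Plücker relations.
SignedExchange : ∀ {n} → (Subset n → Set) → Set
SignedExchange 𝓜 = ∀ I J i → I ! i ≡ false → J ! i ≡ true → 𝓜 (ins i I) → 𝓜 (del i J) →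
  ∃[ j ] (I ! j ≡ false × J ! j ≡ true × sign I J j ≢ sign I J i × 𝓜 (ins j I) × 𝓜 (del j J))

module Components
  {n : ℕ} (𝓜 : Subset n → Set) (signedExchange : SignedExchange 𝓜)
  (stable⇒dec : {Q : Set} → (¬ ¬ Q → Q) → Dec Q)
  where

  -- For the bases of a matroid and distinct x and y this says that x and y lie on a common circuit,
  -- so `E` generates the connected components.
  E : Fin n → Fin n → Set
  E x y = ∃[ I ] (I ! x ≡ false × I ! y ≡ false × 𝓜 (ins x I) × 𝓜 (ins y I))

  E-sym : ∀ {x y} → E x y → E y x
  E-sym (I , x∉I , y∉I , Ix , Iy) = I , y∉I , x∉I , Iy , Ix

  -- A union of components; in matroid terms, a direct summand.
  record Separator (S : Subset n) : Set where
    constructor separator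
    field
      closed : ∀ {x y} → E x y → S ! x ≡ true → S ! y ≡ true
  open Separator

  Separator-∉ : ∀ {S} → Separator S → ∀ {x y} → E x y → S ! x ≡ false → S ! y ≡ false
  Separator-∉ sep exy x∉S = ≢true⇒false λ y∈S → true≢false (closed sep (E-sym exy) y∈S) x∉S

  Separator-∁ : ∀ {S} → Separator S → Separator (∁ S)
  Separator-∁ {S} sep = separator λ {x} {y} exy x∈∁S → trans (Vec.lookup-map y not S) (cong not (Separator-∉ sep exy
    (Bool.not-injective (trans (sym (Vec.lookup-map x not S)) x∈∁S))))

  -- Signed exchange for I = B - i and J = B′ + i: the term at i is the pair B, B′ itself, and the
  -- opposite sign makes j differ from i.
  exchange : ∀ {B B′ i} → 𝓜 B → 𝓜 B′ → B ! i ≡ true → B′ ! i ≡ false →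
             ∃[ j ] (B ! j ≡ false × B′ ! j ≡ true × j ≢ i × 𝓜 (ins j (del i B)))
  exchange {B} {B′} {i} B∈𝓜 B′∈𝓜 i∈B i∉B′
    with signedExchange (del i B) (ins i B′) i (!-del i B) (!-ins i B′)
           (subst 𝓜 (sym (ins-del i B i∈B)) B∈𝓜) (subst 𝓜 (sym (del-ins i B′ i∉B′)) B′∈𝓜)
  ... | j , j∉ , j∈ , signs≢ , Bj∈𝓜 , _ =
    j , trans (sym (!-upd B j≢i)) j∉ , trans (sym (!-upd B′ j≢i)) j∈ , j≢i , Bj∈𝓜
    where
    j≢i : j ≢ i
    j≢i refl = signs≢ refl

  exchange-E : ∀ {B i j} → 𝓜 B → B ! i ≡ true → B ! j ≡ false → j ≢ i → 𝓜 (ins j (del i B)) → E i j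
  exchange-E {B} {i} B∈𝓜 i∈B j∉B j≢i Bj∈𝓜 =
    del i B , !-del i B , trans (!-upd B j≢i) j∉B , subst 𝓜 (sym (ins-del i B i∈B)) B∈𝓜 , Bj∈𝓜

  -- Exchanging the elements of B outside P and B′ one at a time stays in 𝓜 and never
  -- touches P.
  splice-∈𝓜 : ∀ {P} → Separator P → ∀ {B′} → 𝓜 B′ → ∀ {B} → 𝓜 B → 𝓜 (splice P B B′)
  splice-∈𝓜 {P} sep {B′} B′∈𝓜 B∈𝓜 = go _ B∈𝓜 refl
    where
    go : ∀ k {B} → 𝓜 B → excess P B B′ ≡ k → 𝓜 (splice P B B′)
    go k {B} B∈𝓜 eq with Fin.any? (λ i → (P ! i Bool.≟ false) ×-dec (B ! i Bool.≟ true) ×-dec (B′ ! i Bool.≟ false))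
    go zero {B} B∈𝓜 eq | yes (i , i∉P , i∈B , i∉B′) =
      contradiction (trans (excess-del P B B′ i i∉P i∈B i∉B′) eq) λ ()
    go (suc k) {B} B∈𝓜 eq | yes (i , i∉P , i∈B , i∉B′) with exchange B∈𝓜 B′∈𝓜 i∈B i∉B′
    ... | j , j∉B , j∈B′ , j≢i , Bj∈𝓜 = subst 𝓜
      (trans (splice-upd-∉ P (del i B) B′ j j∉P) (splice-upd-∉ P B B′ i i∉P))
      (go k Bj∈𝓜 (trans (excess-ins P (del i B) B′ j j∈B′)
        (ℕ.suc-injective (trans (excess-del P B B′ i i∉P i∈B i∉B′) eq))))
      where
      j∉P : P ! j ≡ false
      j∉P = Separator-∉ sep (exchange-E B∈𝓜 i∈B j∉B j≢i Bj∈𝓜) i∉P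
    go k {B} B∈𝓜 eq | no B∖P⊆B′ = subst 𝓜 (sym (splice-≡ˡ P B B′ agree)) B∈𝓜
      where
      agree : ∀ i → P ! i ≡ false → B ! i ≡ B′ ! i
      agree i i∉P with B ! i in Bi | B′ ! i in B′i
      ... | true  | true  = refl
      ... | false | false = refl
      ... | true  | false = ⊥-elim (B∖P⊆B′ (i , i∉P , Bi , B′i))
      -- Exchanging i out of B′ would bring in some j of B - B′. Like i it lies off P, and no such
      -- element is left.
      ... | false | true with exchange B′∈𝓜 B∈𝓜 B′i Bi
      ...   | j , j∉B′ , j∈B , j≢i , B′j∈𝓜 = ⊥-elim (B∖P⊆B′ (j ,
              Separator-∉ sep (exchange-E B′∈𝓜 B′i j∉B′ j≢i B′j∈𝓜) i∉P , j∈B , j∉B′))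

  -- The splice of B and B′ along P is in `𝓜`, so it has as many elements as B′; the two agree off P
  -- and are therefore equally large on P.
  ∣∩separator∣ : ∀ {d} → (∀ {B} → 𝓜 B → ∣ B ∣ ≡ d) → ∀ {P} → Separator P → ∀ {B B′} → 𝓜 B → 𝓜 B′ →
                 ∣ B ∩ P ∣ ≡ ∣ B′ ∩ P ∣
  ∣∩separator∣ ∣𝓜∣ {P} sep {B} {B′} B∈𝓜 B′∈𝓜 = ℕ.+-cancelʳ-≡ ∣ B′ ∩ ∁ P ∣ _ _
    (trans (sym (∣splice∣ P B B′)) (trans (∣𝓜∣ (splice-∈𝓜 sep B′∈𝓜 B∈𝓜))
      (trans (sym (∣𝓜∣ B′∈𝓜)) (sym (∣∩∣+∣∩∁∣ B′ P)))))

  -- Splicing the two exchanges gives S with Sab, Scd, Sad, Sbc in 𝓜. The three-term Plücker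
  -- relation, with I = Sa and J = Sbcd, then puts Sac in 𝓜, so that b and c are exchangeable.
  exchanges-don't-cross : ∀ {P} → Separator P → ∀ {a b c d} → a < b → b < c → c < d →
    P ! a ≡ true → P ! c ≡ true → P ! b ≡ false → P ! d ≡ false → E a c → E b d → ⊥
  exchanges-don't-cross {P} sep {a} {b} {c} {d} a<b b<c c<d a∈P c∈P b∉P d∉P
    (I₁ , a∉I₁ , c∉I₁ , I₁a , I₁c) (I₂ , b∉I₂ , d∉I₂ , I₂b , I₂d) =
    conclude (signedExchange I J b b∉I (!-ins b (ins c (ins d S))) Sab (subst 𝓜 (sym (del-ins b _ b∉Sdc)) Scd))
    where
    a<c = Fin.<-trans a<b b<c
    b<d = Fin.<-trans b<c c<d
    a<d = Fin.<-trans a<c c<d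
    S I J : Subset n
    S = splice P I₁ I₂
    I = ins a S
    J = ins b (ins c (ins d S))
    a∉S : S ! a ≡ false
    a∉S = trans (!-splice-∈ P I₁ I₂ a∈P) a∉I₁
    c∉S : S ! c ≡ false
    c∉S = trans (!-splice-∈ P I₁ I₂ c∈P) c∉I₁
    b∉S : S ! b ≡ false
    b∉S = trans (!-splice-∉ P I₁ I₂ b∉P) b∉I₂
    d∉S : S ! d ≡ false
    d∉S = trans (!-splice-∉ P I₁ I₂ d∉P) d∉I₂
    b∉I : I ! b ≡ false
    b∉I = trans (!-upd S (Fin.<⇒≢ a<b ∘ sym)) b∉S
    c∉I : I ! c ≡ false
    c∉I = trans (!-upd S (Fin.<⇒≢ a<c ∘ sym)) c∉S
    c∉Sd : ins d S ! c ≡ false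
    c∉Sd = trans (!-upd S (Fin.<⇒≢ c<d)) c∉S
    b∉Sd : ins d S ! b ≡ false
    b∉Sd = trans (!-upd S (Fin.<⇒≢ b<d)) b∉S
    b∉Sdc : ins c (ins d S) ! b ≡ false
    b∉Sdc = trans (!-upd (ins d S) (Fin.<⇒≢ b<c)) b∉Sd
    splice₂ : ∀ x y → P ! x ≡ true → P ! y ≡ false → splice P (ins x I₁) (ins y I₂) ≡ ins y (ins x S)
    splice₂ x y x∈P y∉P = trans (splice-updʳ P (ins x I₁) I₂ y y∉P) (cong (ins y) (splice-updˡ P I₁ I₂ x x∈P))
    Sab : 𝓜 (ins b (ins a S))
    Sab = subst 𝓜 (splice₂ a b a∈P b∉P) (splice-∈𝓜 sep I₂b I₁a)
    Scd : 𝓜 (ins c (ins d S))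
    Scd = subst 𝓜 (trans (splice₂ c d c∈P d∉P) (upd-comm S (Fin.<⇒≢ c<d))) (splice-∈𝓜 sep I₂d I₁c)
    -- Compared with S, the set I has the one extra element a below b and below d, while J has none
    -- below b and the two elements b, c below d. Both signs are thus negative, and d cannot
    -- compensate b.
    same-sign : sign I J d ≡ sign I J b
    same-sign = trans
      (cong₂ _xor_ (parity-ins-< S a∉S a<d)
        (trans (parity-ins-< (ins c (ins d S)) b∉Sdc b<d)
          (trans (cong not (trans (parity-ins-< (ins d S) c∉Sd c<d)
            (cong not (parity-ins-≮ S (Fin.<-irrefl refl))))) (Bool.not-involutive (parity S d)))))
      (trans (Bool.xor-inverseˡ (parity S d)) (sym (trans
        (cong₂ _xor_ (parity-ins-< S a∉S a<b)
          (trans (parity-ins-≮ (ins c (ins d S)) (Fin.<-irrefl refl))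
            (trans (parity-ins-≮ (ins d S) (Fin.<-asym b<c)) (parity-ins-≮ S (Fin.<-asym b<d)))))
        (Bool.xor-inverseˡ (parity S b)))))
    conclude : ∃[ j ] (I ! j ≡ false × J ! j ≡ true × sign I J j ≢ sign I J b × 𝓜 (ins j I) × 𝓜 (del j J)) → ⊥
    conclude (j , j∉I , j∈J , signs≢ , Ij , _) with ∈-upd⁻ (ins c (ins d S)) j∈J
    ... | inj₁ refl = signs≢ refl
    ... | inj₂ h with ∈-upd⁻ (ins d S) h
    ...   | inj₁ refl = true≢false (closed sep (I , c∉I , b∉I , Ij , Sab) c∈P) b∉P
    ...   | inj₂ h with ∈-upd⁻ S h
    ...     | inj₁ refl = signs≢ same-sign
    ...     | inj₂ j∈S = true≢false j∈S (proj₂ (∉-ins⁻ S j∉I))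

  infix 4 _~_
  -- Quantifying over separators instead of over paths of exchanges makes the relation stable, hence
  -- decidable.
  _~_ : Fin n → Fin n → Set
  i ~ j = ∀ S → Separator S → S ! i ≡ true → S ! j ≡ true

  ~-refl : ∀ {i} → i ~ i
  ~-refl S sep i∈S = i∈S

  ~-trans : ∀ {i j k} → i ~ j → j ~ k → i ~ k
  ~-trans i~j j~k S sep i∈S = j~k S sep (i~j S sep i∈S)

  -- A separator containing j but not i would have a complement that separates i from j.
  ~-sym : ∀ {i j} → i ~ j → j ~ i
  ~-sym {i} {j} i~j S sep j∈S with S ! i in Si
  ... | true  = refl
  ... | false = ⊥-elim (true≢false j∈S (Bool.not-injective (trans (sym (Vec.lookup-map j not S))
                  (i~j (∁ S) (Separator-∁ sep) (trans (Vec.lookup-map i not S) (cong not Si))))))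

  _~?_ : ∀ i j → Dec (i ~ j)
  i ~? j = stable⇒dec λ ¬¬i~j S sep i∈S → decidable-stable (S ! j Bool.≟ true) λ j∉S →
    ¬¬i~j λ i~j → j∉S (i~j S sep i∈S)

  E⇒~ : ∀ {i j} → E i j → i ~ j
  E⇒~ eij S sep = closed sep eij

  component : Fin n → Subset n
  component i = setOf (i ~?_)

  component-separator : ∀ i → Separator (component i)
  component-separator i = separator λ exy x∈ → ∈setOf⁺ (i ~?_) (~-trans (∈setOf⁻ (i ~?_) x∈) (E⇒~ exy))

  -- Induction along exchanges: the elements of P satisfying `U` form a separator, which c ~ a
  -- cannot leave.
  spread : ∀ {P} → Separator P → {U : Fin n → Set} (U? : ∀ x → Dec (U x)) →
    (∀ {x y} → E x y → P ! x ≡ true → P ! y ≡ true → U x → U y) →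
    ∀ {c a} → c ~ a → P ! c ≡ true → U c → U a
  spread {P} sep {U} U? U-closed c~a c∈P Uc =
    proj₂ (∈setOf⁻ PU? (c~a (setOf PU?) PU-separator (∈setOf⁺ PU? (c∈P , Uc))))
    where
    PU? : ∀ x → Dec (P ! x ≡ true × U x)
    PU? x = (P ! x Bool.≟ true) ×-dec U? x
    PU-separator : Separator (setOf PU?)
    PU-separator = separator λ exy x∈ → case ∈setOf⁻ PU? x∈ of λ where
      (x∈P , Ux) → ∈setOf⁺ PU? (closed sep exy x∈P , U-closed exy x∈P (closed sep exy x∈P) Ux)

  Between : Fin n → Fin n → Fin n → Set
  Between x y z = x < z × z < y

  between? : ∀ x y z → Dec (Between x y z)
  between? x y z = (x Fin.<? z) ×-dec (z Fin.<? y)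

  -- If z′ left the interval from x to y, the two exchanges would cross. For z′ below x the smallest
  -- element is off P, so the complement of P takes its place.
  exchange-fence : ∀ {P} → Separator P → ∀ {x y z z′} → E x y → P ! x ≡ true → P ! y ≡ true →
    E z z′ → P ! z ≡ false → P ! z′ ≡ false → Between x y z → Between x y z′
  exchange-fence {P} sep {x} {y} {z} {z′} exy x∈P y∈P ezz′ z∉P z′∉P (x<z , z<y)
    with Fin.<-cmp x z′ | Fin.<-cmp z′ y
  ... | tri< x<z′ _ _ | tri< z′<y _ _ = x<z′ , z′<y
  ... | tri≈ _ refl _ | _             = ⊥-elim (true≢false x∈P z′∉P)
  ... | _             | tri≈ _ refl _ = ⊥-elim (true≢false y∈P z′∉P)
  ... | _             | tri> _ _ y<z′ = ⊥-elim (exchanges-don't-cross sep x<z z<y y<z′ x∈P y∈P z∉P z′∉P exy ezz′)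
  ... | tri> _ _ z′<x | _             = ⊥-elim (exchanges-don't-cross (Separator-∁ sep) z′<x x<z z<y
      (∁-∉ z′∉P) (∁-∉ z∉P) (∁-∈ x∈P) (∁-∈ y∈P) (E-sym ezz′) exy)
    where
    ∁-∉ : ∀ {k} → P ! k ≡ false → ∁ P ! k ≡ true
    ∁-∉ {k} h = trans (Vec.lookup-map k not P) (cong not h)
    ∁-∈ : ∀ {k} → P ! k ≡ true → ∁ P ! k ≡ false
    ∁-∈ {k} h = trans (Vec.lookup-map k not P) (cong not h)

  -- Otherwise an exchange within the component of i would cross the pair b, d, and then
  -- an exchange within the component of j would cross that one.
  components-noncrossing : ∀ {i j} → ¬ (i ~ j) → ∀ {a b c d} → i ~ a → i ~ c → j ~ b → j ~ d →
    Between b d c → Between b d a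
  components-noncrossing {i} {j} i≁j {a} {b} {c} {d} i~a i~c j~b j~d =
    spread P-sep (between? b d) stays (~-trans (~-sym i~c) i~a) (∈P i~c)
    where
    P = component i
    Q = component j
    P-sep = component-separator i
    ∈P : ∀ {x} → i ~ x → P ! x ≡ true
    ∈P = ∈setOf⁺ (i ~?_)
    Q∌P : ∀ {x} → Q ! x ≡ true → P ! x ≡ false
    Q∌P x∈Q = ≢true⇒false λ x∈P → i≁j (~-trans (∈setOf⁻ (i ~?_) x∈P) (~-sym (∈setOf⁻ (j ~?_) x∈Q)))
    b∈Q = ∈setOf⁺ (j ~?_) j~b
    d∈Q = ∈setOf⁺ (j ~?_) j~d
    b~d = ~-trans (~-sym j~b) j~d
    -- A single exchange in P fences in whole components: `spread` passes from exchanges inside Q to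
    -- z ~ z′.
    fence : ∀ {x y z z′} → E x y → P ! x ≡ true → P ! y ≡ true → Q ! z ≡ true → z ~ z′ →
            Between x y z → Between x y z′
    fence exy x∈P y∈P z∈Q z~z′ = spread (component-separator j) (between? _ _)
      (λ euv u∈Q v∈Q → exchange-fence P-sep exy x∈P y∈P euv (Q∌P u∈Q) (Q∌P v∈Q)) z~z′ z∈Q
    -- If y fell below b, then b would lie between y and x, and the fence would put d there too,
    -- against x < d. The case of y above d is the mirror image.
    stays : ∀ {x y} → E x y → P ! x ≡ true → P ! y ≡ true → Between b d x → Between b d y
    stays {x} {y} exy x∈P y∈P (b<x , x<d) with Fin.<-cmp b y | Fin.<-cmp y d
    ... | tri< b<y _ _  | tri< y<d _ _  = b<y , y<d
    ... | tri≈ _ refl _ | _             = ⊥-elim (true≢false y∈P (Q∌P b∈Q))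
    ... | _             | tri≈ _ refl _ = ⊥-elim (true≢false y∈P (Q∌P d∈Q))
    ... | tri> _ _ y<b  | _             =
      ⊥-elim (Fin.<-asym x<d (proj₂ (fence (E-sym exy) y∈P x∈P b∈Q b~d (y<b , b<x))))
    ... | _             | tri> _ _ d<y  =
      ⊥-elim (Fin.<-asym b<x (proj₁ (fence exy x∈P y∈P d∈Q (~-sym b~d) (x<d , d<y))))

-- Non-crossing pairs of blocks and non-crossing partitions.

Uncrossed : ∀ {n} → Subset n → Subset n → Set
Uncrossed S C = ∀ {b d x y} → b ∈ C → d ∈ C → x ∈ S → y ∈ S → b < x × x < d → b < y × y < d

disjoint-∉ : ∀ {n} {S T : Subset n} → Empty (S ∩ T) → ∀ {x} → x ∈ S → x ∉ T
disjoint-∉ S∩T≡∅ x∈S x∈T = S∩T≡∅ (_ , Sub.x∈p∩q⁺ (x∈S , x∈T))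

disjoint-sym : ∀ {n} {S T : Subset n} → Empty (S ∩ T) → Empty (T ∩ S)
disjoint-sym {S = S} {T} = subst Empty (Sub.∩-comm S T)

-- In each of the eight cyclic patterns some interval with both ends in C holds one of the two
-- elements of S and not the other.
Uncrossed⇒¬Cross : ∀ {n} {S C : Subset n} → Uncrossed S C → ¬ Cross S C × ¬ Cross C S
Uncrossed⇒¬Cross {S = S} {C} unc = S-C , C-S
  where
  S-C : ¬ Cross S C
  S-C (a , b , c , d , inj₁ (a<b , b<c , c<d) , a∈ , c∈ , b∈ , d∈) =
    Fin.<-asym a<b (proj₁ (unc b∈ d∈ c∈ a∈ (b<c , c<d)))
  S-C (a , b , c , d , inj₂ (inj₁ (b<c , c<d , d<a)) , a∈ , c∈ , b∈ , d∈) =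
    Fin.<-asym d<a (proj₂ (unc b∈ d∈ c∈ a∈ (b<c , c<d)))
  S-C (a , b , c , d , inj₂ (inj₂ (inj₁ (c<d , d<a , a<b))) , a∈ , c∈ , b∈ , d∈) =
    Fin.<-asym c<d (proj₁ (unc d∈ b∈ a∈ c∈ (d<a , a<b)))
  S-C (a , b , c , d , inj₂ (inj₂ (inj₂ (d<a , a<b , b<c))) , a∈ , c∈ , b∈ , d∈) =
    Fin.<-asym b<c (proj₂ (unc d∈ b∈ a∈ c∈ (d<a , a<b)))
  C-S : ¬ Cross C S
  C-S (a , b , c , d , inj₁ (a<b , b<c , c<d) , a∈ , c∈ , b∈ , d∈) =
    Fin.<-asym c<d (proj₂ (unc a∈ c∈ b∈ d∈ (a<b , b<c)))
  C-S (a , b , c , d , inj₂ (inj₁ (b<c , c<d , d<a)) , a∈ , c∈ , b∈ , d∈) =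
    Fin.<-asym b<c (proj₁ (unc c∈ a∈ d∈ b∈ (c<d , d<a)))
  C-S (a , b , c , d , inj₂ (inj₂ (inj₁ (c<d , d<a , a<b))) , a∈ , c∈ , b∈ , d∈) =
    Fin.<-asym a<b (proj₂ (unc c∈ a∈ d∈ b∈ (c<d , d<a)))
  C-S (a , b , c , d , inj₂ (inj₂ (inj₂ (d<a , a<b , b<c))) , a∈ , c∈ , b∈ , d∈) =
    Fin.<-asym d<a (proj₁ (unc a∈ c∈ b∈ d∈ (a<b , b<c)))

¬Cross⇒Uncrossed : ∀ {n} {S C : Subset n} → Empty (S ∩ C) → ¬ Cross S C → Uncrossed S C
¬Cross⇒Uncrossed S∩C≡∅ ¬cross {b} {d} {x} {y} b∈C d∈C x∈S y∈S (b<x , x<d)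
  with Fin.<-cmp b y | Fin.<-cmp y d
... | tri< b<y _ _  | tri< y<d _ _  = b<y , y<d
... | tri≈ _ refl _ | _             = ⊥-elim (disjoint-∉ S∩C≡∅ y∈S b∈C)
... | _             | tri≈ _ refl _ = ⊥-elim (disjoint-∉ S∩C≡∅ y∈S d∈C)
... | tri> _ _ y<b  | _             =
  ⊥-elim (¬cross (y , b , x , d , inj₁ (y<b , b<x , x<d) , y∈S , x∈S , b∈C , d∈C))
... | _             | tri> _ _ d<y  =
  ⊥-elim (¬cross (y , b , x , d , inj₂ (inj₁ (b<x , x<d , d<y)) , y∈S , x∈S , b∈C , d∈C))

-- An element of C separating A from A′ would lie between i and j.
Uncrossed-∪ : ∀ {n} {A A′ C : Subset n} → Uncrossed A C → Uncrossed A′ C → ∀ {i j} → i ∈ A → j ∈ A′ →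
  i ∉ C → j ∉ C → i < j → (∀ {k} → i < k → k < j → k ∉ C) → Uncrossed (A ∪ A′) C
Uncrossed-∪ {A = A} {A′} uncA uncA′ {i} {j} i∈A j∈A′ i∉C j∉C i<j gap {b} {d} b∈C d∈C x∈ y∈ b<x<d
  with Sub.x∈p∪q⁻ A A′ x∈ | Sub.x∈p∪q⁻ A A′ y∈
... | inj₁ x∈A  | inj₁ y∈A  = uncA b∈C d∈C x∈A y∈A b<x<d
... | inj₂ x∈A′ | inj₂ y∈A′ = uncA′ b∈C d∈C x∈A′ y∈A′ b<x<d
... | inj₁ x∈A  | inj₂ y∈A′ = uncA′ b∈C d∈C j∈A′ y∈A′ (across (uncA b∈C d∈C x∈A i∈A b<x<d))
  where
  across : b < i × i < d → b < j × j < d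
  across (b<i , i<d) with Fin.<-cmp j d
  ... | tri< j<d _ _  = Fin.<-trans b<i i<j , j<d
  ... | tri≈ _ refl _ = ⊥-elim (j∉C d∈C)
  ... | tri> _ _ d<j  = ⊥-elim (gap i<d d<j d∈C)
... | inj₂ x∈A′ | inj₁ y∈A  = uncA b∈C d∈C i∈A y∈A (across (uncA′ b∈C d∈C x∈A′ j∈A′ b<x<d))
  where
  across : b < j × j < d → b < i × i < d
  across (b<j , j<d) with Fin.<-cmp b i
  ... | tri< b<i _ _  = b<i , Fin.<-trans i<j j<d
  ... | tri≈ _ refl _ = ⊥-elim (i∉C b∈C)
  ... | tri> _ _ i<b  = ⊥-elim (gap i<b b<j b∈C)

record IsNCPartition {n : ℕ} (P : List (Subset n)) : Set where
  field
    nonempty    : All Nonempty P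
    disjoint    : AllPairs (λ S T → Empty (S ∩ T)) P
    covering    : ∀ i → Any (i ∈_) P
    noncrossing : AllPairs (λ S T → ¬ Cross S T × ¬ Cross T S) P
open IsNCPartition

AllPairs-resp-↭ : {X : Set} {R : X → X → Set} → Symmetric R → ∀ {xs ys} → xs ↭ ys → AllPairs R xs → AllPairs R ys
AllPairs-resp-↭ {X} {R} R-sym p = ↭ₛ.AllPairs-resp-↭ (≡.setoid X) R-sym (subst (R _) , subst (λ x → R x _)) (↭⇒↭ₛ p)

AllPairs-lookup : {X : Set} {R : X → X → Set} → Symmetric R → ∀ {xs x y} → AllPairs R xs →
                  x ∈ˡ xs → y ∈ˡ xs → x ≢ y → R x y
AllPairs-lookup R-sym (rs ∷ ps) (here refl) (here refl) x≢y = ⊥-elim (x≢y refl)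
AllPairs-lookup R-sym (rs ∷ ps) (here refl) (there y∈)  x≢y = All.lookup rs y∈
AllPairs-lookup R-sym (rs ∷ ps) (there x∈)  (here refl) x≢y = R-sym (All.lookup rs x∈)
AllPairs-lookup R-sym (rs ∷ ps) (there x∈)  (there y∈)  x≢y = AllPairs-lookup R-sym ps x∈ y∈ x≢y

∈⇒↭ : {X : Set} {x : X} {xs : List X} → x ∈ˡ xs → ∃[ ys ] (xs ↭ x ∷ ys)
∈⇒↭ {x = x} x∈xs with ∈-∃++ x∈xs
... | ys , zs , refl = ys List.++ zs , ↭.shift x ys zs

IsNCPartition-resp-↭ : ∀ {n} {P Q : List (Subset n)} → P ↭ Q → IsNCPartition P → IsNCPartition Q
IsNCPartition-resp-↭ p part = record
  { nonempty    = ↭.All-resp-↭ p (nonempty part)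
  ; disjoint    = AllPairs-resp-↭ disjoint-sym p (disjoint part)
  ; covering    = λ i → ↭.Any-resp-↭ p (covering part i)
  ; noncrossing = AllPairs-resp-↭ swap p (noncrossing part)
  }

block-unique : ∀ {n} {P : List (Subset n)} → IsNCPartition P → ∀ {S T x} → S ∈ˡ P → T ∈ˡ P → x ∈ S → x ∈ T → S ≡ T
block-unique part {S} {T} S∈P T∈P x∈S x∈T = decidable-stable (Vec.≡-dec Bool._≟_ S T) λ S≢T →
  disjoint-∉ (AllPairs-lookup disjoint-sym (disjoint part) S∈P T∈P S≢T) x∈S x∈T

blocks-distinct : ∀ {n} {P : List (Subset n)} → IsNCPartition P → AllPairs _≢_ P
blocks-distinct part = go (nonempty part) (disjoint part)
  where
  go : ∀ {P} → All Nonempty P → AllPairs (λ S T → Empty (S ∩ T)) P → AllPairs _≢_ P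
  go [] [] = []
  go ((x , x∈S) ∷ ne) (ds ∷ dj) = All.map (λ d e → disjoint-∉ d x∈S (subst (x ∈_) e x∈S)) ds ∷ go ne dj

Same : ∀ {n} → List (Subset n) → Fin n → Fin n → Set
Same P i j = Any (λ S → i ∈ S × j ∈ S) P

same? : ∀ {n} (P : List (Subset n)) i j → Dec (Same P i j)
same? P i j = Any.any? (λ S → (i Sub.∈? S) ×-dec (j Sub.∈? S)) P

Same-trans : ∀ {n} {P : List (Subset n)} → IsNCPartition P → ∀ {i j k} → Same P i j → Same P j k → Same P i k
Same-trans part s t with findˡ s | findˡ t
... | S , S∈P , i∈S , j∈S | T , T∈P , j∈T , k∈T with block-unique part S∈P T∈P j∈S j∈T
...   | refl = loseˡ S∈P (i∈S , k∈T)

_⊑_ : ∀ {n} → List (Subset n) → List (Subset n) → Set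
X ⊑ Y = ∀ {A} → A ∈ˡ X → ∃[ T ] (T ∈ˡ Y × A ⊆ T)

-- If A ⊆ T are blocks of X and Y, all elements of T share a block of X with an element of A, so T =
-- A. The lists thus have the same members, and neither repeats a block.
⊑-antisym : ∀ {n} {X Y : List (Subset n)} → IsNCPartition X → IsNCPartition Y → X ⊑ Y →
            (∀ {i j} → Same Y i j → Same X i j) → X ↭ Y
⊑-antisym {X = X} {Y} partX partY X⊑Y Y⊑X =
  ∼bag⇒↭ (unique∧set⇒bag (blocks-distinct partX) (blocks-distinct partY) (mk⇔ X⊆Y Y⊆X))
  where
  ≡block : ∀ {A T i} → A ∈ˡ X → T ∈ˡ Y → A ⊆ T → i ∈ A → A ≡ T
  ≡block {A} {T} A∈X T∈Y A⊆T i∈A = Sub.⊆-antisym A⊆T T⊆A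
    where
    T⊆A : T ⊆ A
    T⊆A k∈T with findˡ (Y⊑X (loseˡ T∈Y (A⊆T i∈A , k∈T)))
    ... | S , S∈X , i∈S , k∈S = subst (_ ∈_) (block-unique partX S∈X A∈X i∈S i∈A) k∈S
  X⊆Y : ∀ {A} → A ∈ˡ X → A ∈ˡ Y
  X⊆Y A∈X with X⊑Y A∈X | All.lookup (nonempty partX) A∈X
  ... | T , T∈Y , A⊆T | i , i∈A = subst (_∈ˡ Y) (sym (≡block A∈X T∈Y A⊆T i∈A)) T∈Y
  Y⊆X : ∀ {T} → T ∈ˡ Y → T ∈ˡ X
  Y⊆X T∈Y with All.lookup (nonempty partY) T∈Y
  ... | i , i∈T with findˡ (covering partX i)
  ...   | A , A∈X , i∈A with X⊑Y A∈X
  ...     | T′ , T′∈Y , A⊆T′ = subst (_∈ˡ X)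
            (trans (≡block A∈X T′∈Y A⊆T′ i∈A) (block-unique partY T′∈Y T∈Y (A⊆T′ i∈A) i∈T)) A∈X

-- Weights read off from a set, and refinements as chains of covers.

label : ∀ {n} → Subset n → List (Subset n) → WPart n
label B = map (λ S → S , ∣ B ∩ S ∣)

∩∁-∩ : ∀ {n} (B S T : Subset n) → Empty (S ∩ T) → (B ∩ ∁ S) ∩ T ≡ B ∩ T
∩∁-∩ B S T S∩T≡∅ = Sub.⊆-antisym to from
  where
  to : (B ∩ ∁ S) ∩ T ⊆ B ∩ T
  to x∈ with Sub.x∈p∩q⁻ (B ∩ ∁ S) T x∈
  ... | x∈B∖S , x∈T = Sub.x∈p∩q⁺ (proj₁ (Sub.x∈p∩q⁻ B (∁ S) x∈B∖S) , x∈T)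
  from : B ∩ T ⊆ (B ∩ ∁ S) ∩ T
  from x∈ with Sub.x∈p∩q⁻ B T x∈
  ... | x∈B , x∈T = Sub.x∈p∩q⁺ (Sub.x∈p∩q⁺ (x∈B , Sub.x∉p⇒x∈∁p (λ x∈S → disjoint-∉ S∩T≡∅ x∈S x∈T)) , x∈T)

-- The induction removes S from B, which leaves the intersections with the later blocks unchanged
-- because these are disjoint from S.
blockSum-label : ∀ {n} (B : Subset n) P → AllPairs (λ S T → Empty (S ∩ T)) P →
                 (∀ {i} → i ∈ B → Any (i ∈_) P) → blockSum (label B P) ≡ ∣ B ∣
blockSum-label {n} B [] [] cov = sym (trans (cong ∣_∣ (Sub.Empty-unique {p = B} λ (i , i∈B) → case cov i∈B of λ ())) (Sub.∣⊥∣≡0 n))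
blockSum-label B (S ∷ P) (ds ∷ dj) cov = trans
  (cong (∣ B ∩ S ∣ ℕ.+_) (trans (cong blockSum {x = label B P} (sym (List.map-cong-local
    (All.map (λ {T} d → cong (λ Z → T , ∣ Z ∣) (∩∁-∩ B S T d)) ds)))) (blockSum-label (B ∩ ∁ S) P dj cov′)))
  (∣∩∣+∣∩∁∣ B S)
  where
  cov′ : ∀ {i} → i ∈ B ∩ ∁ S → Any (i ∈_) P
  cov′ i∈ with Sub.x∈p∩q⁻ B (∁ S) i∈
  ... | i∈B , i∈∁S with cov i∈B
  ...   | here i∈S = ⊥-elim (Sub.x∈∁p⇒x∉p i∈∁S i∈S)
  ...   | there i∈P = i∈P

label-isWNC : ∀ {n d} (B : Subset n) → ∣ B ∣ ≡ d → ∀ {P} → IsNCPartition P → IsWNC n d (label B P)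
label-isWNC B ∣B∣≡d {P} part = record
  { nonempty    = All.map⁺ (nonempty part)
  ; disjoint    = AllPairs.map⁺ (disjoint part)
  ; covering    = λ i → Any.map⁺ (covering part i)
  ; noncrossing = AllPairs.map⁺ (noncrossing part)
  ; weightBound = All.map⁺ (All.universal (λ S → Sub.∣p∩q∣≤∣q∣ B S) P)
  ; totalWeight = trans (blockSum-label B P (disjoint part) (λ {i} _ → covering part i)) ∣B∣≡d
  }

Gap : ∀ {n} → Subset n → Fin n → Fin n → Set
Gap T i j = ∀ {k} → i < k → k < j → k ∉ T

-- The number m bounds the distance from i to j. An element k of T between them is not joined to
-- both, `Same` being transitive, so one of the two shorter pairs is again unjoined.
closest-pair : ∀ {n} {X : List (Subset n)} → IsNCPartition X → (T : Subset n) → ∀ m {i j} →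
  toℕ j ℕ.≤ m ℕ.+ toℕ i → i < j → i ∈ T → j ∈ T → ¬ Same X i j →
  ∃[ i′ ] ∃[ j′ ] (i′ < j′ × i′ ∈ T × j′ ∈ T × ¬ Same X i′ j′ × Gap T i′ j′)
closest-pair partX T zero j≤i i<j _ _ _ = ⊥-elim (ℕ.<⇒≱ i<j j≤i)
closest-pair {X = X} partX T (suc m) {i} {j} j≤ i<j i∈T j∈T i≁j
  with Fin.any? (λ k → (i Fin.<? k) ×-dec (k Fin.<? j) ×-dec (k Sub.∈? T))
... | no gap = i , j , i<j , i∈T , j∈T , i≁j , λ i<k k<j k∈T → gap (_ , i<k , k<j , k∈T)
... | yes (k , i<k , k<j , k∈T) with same? X i k
...   | no i≁k  = closest-pair partX T m (ℕ.≤-pred (ℕ.≤-trans k<j j≤)) i<k i∈T k∈T i≁k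
...   | yes i~k = closest-pair partX T m
        (ℕ.≤-trans j≤ (ℕ.≤-trans (ℕ.≤-reflexive (sym (ℕ.+-suc m (toℕ i)))) (ℕ.+-monoʳ-≤ m i<k)))
        k<j k∈T j∈T (λ k~j → i≁j (Same-trans partX i~k k~j))

∪∩∁ : ∀ {n} (A A′ : Subset n) → Empty (A ∩ A′) → (A ∪ A′) ∩ ∁ A ≡ A′
∪∩∁ A A′ A∩A′≡∅ = Sub.⊆-antisym to from
  where
  to : (A ∪ A′) ∩ ∁ A ⊆ A′
  to x∈ with Sub.x∈p∩q⁻ (A ∪ A′) (∁ A) x∈
  ... | x∈A∪A′ , x∈∁A with Sub.x∈p∪q⁻ A A′ x∈A∪A′
  ...   | inj₁ x∈A  = ⊥-elim (Sub.x∈∁p⇒x∉p x∈∁A x∈A)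
  ...   | inj₂ x∈A′ = x∈A′
  from : A′ ⊆ (A ∪ A′) ∩ ∁ A
  from x∈A′ = Sub.x∈p∩q⁺ (Sub.q⊆p∪q A A′ x∈A′ , Sub.x∉p⇒x∈∁p (λ x∈A → disjoint-∉ A∩A′≡∅ x∈A x∈A′))

∣∩∣-split : ∀ {n} (B : Subset n) {A T : Subset n} → A ⊆ T → ∣ B ∩ A ∣ ℕ.+ ∣ B ∩ (T ∩ ∁ A) ∣ ≡ ∣ B ∩ T ∣
∣∩∣-split B {A} {T} A⊆T = trans (cong₂ ℕ._+_ (cong ∣_∣ inner) (cong ∣_∣ (sym (Sub.∩-assoc B T (∁ A))))) (∣∩∣+∣∩∁∣ (B ∩ T) A)
  where
  inner : B ∩ A ≡ (B ∩ T) ∩ A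
  inner = Sub.⊆-antisym
    (λ x∈ → case Sub.x∈p∩q⁻ B A x∈ of λ (x∈B , x∈A) → Sub.x∈p∩q⁺ (Sub.x∈p∩q⁺ (x∈B , A⊆T x∈A) , x∈A))
    (λ x∈ → case Sub.x∈p∩q⁻ (B ∩ T) A x∈ of λ (x∈B∩T , x∈A) → Sub.x∈p∩q⁺ (proj₁ (Sub.x∈p∩q⁻ B T x∈B∩T) , x∈A))

merge-⋖ : ∀ {n} (B A A′ : Subset n) X → Nonempty A → Nonempty A′ → Empty (A ∩ A′) →
          label B (A ∷ A′ ∷ X) ⋖ label B ((A ∪ A′) ∷ X)
merge-⋖ B A A′ X A≢∅ (y , y∈A′) A∩A′≡∅ =
  label B X , A ∪ A′ , A , ∣ B ∩ A ∣ , ∣ B ∩ A′ ∣ , A≢∅ ,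
  (Sub.p⊆p∪q A′ , y , Sub.q⊆p∪q A A′ y∈A′ , λ y∈A → disjoint-∉ A∩A′≡∅ y∈A y∈A′) ,
  ↭-reflexive (cong (λ w → (A ∪ A′ , w) ∷ label B X)
    (sym (trans (cong (λ Z → ∣ B ∩ A ∣ ℕ.+ ∣ B ∩ Z ∣) (sym (∪∩∁ A A′ A∩A′≡∅))) (∣∩∣-split B (Sub.p⊆p∪q A′))))) ,
  ↭-reflexive (cong (λ Z → (A , ∣ B ∩ A ∣) ∷ (Z , ∣ B ∩ A′ ∣) ∷ label B X) (sym (∪∩∁ A A′ A∩A′≡∅)))

⋖-respˡ : ∀ {n} {S S′ T : WPart n} → S′ ↭ S → S ⋖ T → S′ ⋖ T
⋖-respˡ p (rest , Th , A , a , b , A≢∅ , A⊂Th , T↭ , S↭) = rest , Th , A , a , b , A≢∅ , A⊂Th , T↭ , ↭-trans p S↭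

-- A block inside another block of Y than T does not cross A ∪ A′ since Y is non-crossing. A block
-- inside T has no element between i and j, so `Uncrossed-∪` applies.
merge-isNCPartition : ∀ {n} {A A′ : Subset n} {X Y : List (Subset n)} →
  IsNCPartition (A ∷ A′ ∷ X) → IsNCPartition Y → (A ∷ A′ ∷ X) ⊑ Y →
  ∀ {T i j} → T ∈ˡ Y → A ⊆ T → A′ ⊆ T → i ∈ A → j ∈ A′ → i < j → Gap T i j →
  IsNCPartition ((A ∪ A′) ∷ X)
merge-isNCPartition {A = A} {A′} {X} {Y} part partY X⊑Y {T} {i} {j} T∈Y A⊆T A′⊆T i∈A j∈A′ i<j gap
  with nonempty part | disjoint part | noncrossing part
... | _ ∷ _ ∷ ne | (_ ∷ dA) ∷ dA′ ∷ dX | (_ ∷ ncA) ∷ ncA′ ∷ ncX = record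
  { nonempty    = (i , Sub.p⊆p∪q A′ i∈A) ∷ ne
  ; disjoint    = All.zipWith disjoint-∪ (dA , dA′) ∷ dX
  ; covering    = λ k → cover (covering part k)
  ; noncrossing = All.tabulate (λ C∈X → Uncrossed⇒¬Cross (uncrossed C∈X)) ∷ ncX
  }
  where
  disjoint-∪ : ∀ {C} → Empty (A ∩ C) × Empty (A′ ∩ C) → Empty ((A ∪ A′) ∩ C)
  disjoint-∪ {C} (d , d′) (x , x∈) with Sub.x∈p∩q⁻ (A ∪ A′) C x∈
  ... | x∈∪ , x∈C with Sub.x∈p∪q⁻ A A′ x∈∪
  ...   | inj₁ x∈A  = disjoint-∉ d x∈A x∈C
  ...   | inj₂ x∈A′ = disjoint-∉ d′ x∈A′ x∈C
  cover : ∀ {k} → Any (k ∈_) (A ∷ A′ ∷ X) → Any (k ∈_) ((A ∪ A′) ∷ X)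
  cover (here k∈A)          = here (Sub.p⊆p∪q A′ k∈A)
  cover (there (here k∈A′)) = here (Sub.q⊆p∪q A A′ k∈A′)
  cover (there (there k∈X)) = there k∈X
  ∪⊆T : ∀ {x} → x ∈ A ∪ A′ → x ∈ T
  ∪⊆T x∈ = [ A⊆T , A′⊆T ]′ (Sub.x∈p∪q⁻ A A′ x∈)
  uncrossed : ∀ {C} → C ∈ˡ X → Uncrossed (A ∪ A′) C
  uncrossed {C} C∈X with X⊑Y (there (there C∈X))
  ... | T′ , T′∈Y , C⊆T′ with Vec.≡-dec Bool._≟_ T T′
  ...   | no T≢T′ = λ b∈C d∈C x∈ y∈ → ¬Cross⇒Uncrossed
            (AllPairs-lookup disjoint-sym (disjoint partY) T∈Y T′∈Y T≢T′)
            (proj₁ (AllPairs-lookup {R = λ S T → ¬ Cross S T × ¬ Cross T S} swap (noncrossing partY) T∈Y T′∈Y T≢T′))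
            (C⊆T′ b∈C) (C⊆T′ d∈C) (∪⊆T x∈) (∪⊆T y∈)
  ...   | yes refl = Uncrossed-∪
            (¬Cross⇒Uncrossed (All.lookup dA C∈X) (proj₁ (All.lookup ncA C∈X)))
            (¬Cross⇒Uncrossed (All.lookup dA′ C∈X) (proj₁ (All.lookup ncA′ C∈X)))
            i∈A j∈A′ (disjoint-∉ (All.lookup dA C∈X) i∈A) (disjoint-∉ (All.lookup dA′ C∈X) j∈A′)
            i<j (λ i<k k<j k∈C → gap i<k k<j (C⊆T′ k∈C))

-- Read upwards, a cover merges two blocks; merging the blocks of a closest pair of
-- elements of a block of Y keeps the partition non-crossing.
⊑⇒≤NC : ∀ {n d} (B : Subset n) → ∣ B ∣ ≡ d → ∀ m {X Y} → length X ℕ.≤ m →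
  IsNCPartition X → (partY : IsNCPartition Y) → X ⊑ Y →
  (wX : IsWNC n d (label B X)) (wY : IsWNC n d (label B Y)) → (label B X , wX) ≤NC (label B Y , wY)
⊑⇒≤NC {n} {d} B ∣B∣≡d m {X} {Y} ∣X∣≤m partX partY X⊑Y wX wY
  with Fin.any? (λ i → Fin.any? (λ j → (i Fin.<? j) ×-dec same? Y i j ×-dec ¬? (same? X i j)))
... | no none = inj₂ (↭.map⁺ _ (⊑-antisym partX partY X⊑Y Y⊑X)) ◅ ε
  where
  Same-sym : ∀ {P : List (Subset n)} {i j} → Same P i j → Same P j i
  Same-sym = Any.map swap
  ordered : ∀ {i j} → i < j → Same Y i j → Same X i j
  ordered {i} {j} i<j sY = decidable-stable (same? X i j) λ ¬sX → none (i , j , i<j , sY , ¬sX)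
  Y⊑X : ∀ {i j} → Same Y i j → Same X i j
  Y⊑X {i} {j} sY with Fin.<-cmp i j
  ... | tri< i<j _ _  = ordered i<j sY
  ... | tri≈ _ refl _ = Any.map (λ h → h , h) (covering partX i)
  ... | tri> _ _ j<i  = Same-sym (ordered j<i (Same-sym sY))
... | yes (i₀ , j₀ , i₀<j₀ , sY , ¬sX) with findˡ sY
...   | T , T∈Y , i₀∈T , j₀∈T with closest-pair partX T (toℕ j₀) (ℕ.m≤m+n _ _) i₀<j₀ i₀∈T j₀∈T ¬sX
...     | i , j , i<j , i∈T , j∈T , i≁j , gap with findˡ (covering partX i) | findˡ (covering partX j)
...       | A , A∈X , i∈A | A′ , A′∈X , j∈A′ with ∈⇒↭ A∈X
...         | X₁ , X↭A∷X₁ with ↭.∈-resp-↭ X↭A∷X₁ A′∈X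
...           | here refl = ⊥-elim (i≁j (loseˡ A∈X (i∈A , j∈A′)))
...           | there A′∈X₁ with ∈⇒↭ A′∈X₁
...             | X₂ , X₁↭A′∷X₂ = go m ∣X∣≤m
  where
  X↭ : X ↭ A ∷ A′ ∷ X₂
  X↭ = ↭-trans X↭A∷X₁ (↭-prep A X₁↭A′∷X₂)
  part : IsNCPartition (A ∷ A′ ∷ X₂)
  part = IsNCPartition-resp-↭ X↭ partX
  ⊑Y : (A ∷ A′ ∷ X₂) ⊑ Y
  ⊑Y C∈ = X⊑Y (↭.∈-resp-↭ (↭-sym X↭) C∈)
  ⊆T : ∀ {C k} → C ∈ˡ X → k ∈ C → k ∈ T → C ⊆ T
  ⊆T C∈X k∈C k∈T with X⊑Y C∈X
  ... | T′ , T′∈Y , C⊆T′ = subst (_ ⊆_) (block-unique partY T′∈Y T∈Y (C⊆T′ k∈C) k∈T) C⊆T′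
  A⊆T : A ⊆ T
  A⊆T = ⊆T A∈X i∈A i∈T
  A′⊆T : A′ ⊆ T
  A′⊆T = ⊆T A′∈X j∈A′ j∈T
  merged : IsNCPartition ((A ∪ A′) ∷ X₂)
  merged = merge-isNCPartition part partY ⊑Y T∈Y A⊆T A′⊆T i∈A j∈A′ i<j gap
  merged⊑Y : ((A ∪ A′) ∷ X₂) ⊑ Y
  merged⊑Y (here refl) = T , T∈Y , λ x∈ → [ A⊆T , A′⊆T ]′ (Sub.x∈p∪q⁻ A A′ x∈)
  merged⊑Y (there C∈)  = ⊑Y (there (there C∈))
  cover : label B X ⋖ label B ((A ∪ A′) ∷ X₂)
  cover = ⋖-respˡ (↭.map⁺ _ X↭) (merge-⋖ B A A′ X₂ (i , i∈A) (j , j∈A′)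
            (All.head (AllPairs.head (disjoint part))))
  -- A merge shortens the list by one, so the bound on its length drops; two blocks being present,
  -- the bound is not zero.
  go : ∀ m → length X ℕ.≤ m → (label B X , wX) ≤NC (label B Y , wY)
  go zero ∣X∣≤0 = contradiction (ℕ.≤-trans (ℕ.≤-reflexive (sym (↭.↭-length X↭))) ∣X∣≤0) λ ()
  go (suc m) ∣X∣≤1+m = inj₁ {B = label B X ↭ label B ((A ∪ A′) ∷ X₂)} cover ◅
    ⊑⇒≤NC B ∣B∣≡d m (ℕ.≤-pred (ℕ.≤-trans (ℕ.≤-reflexive (sym (↭.↭-length X↭))) ∣X∣≤1+m))
      merged partY merged⊑Y (label-isWNC B ∣B∣≡d merged) wY

!⇒∈ : ∀ {n} {B : Subset n} {i} → B ! i ≡ true → i ∈ B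
!⇒∈ {B = B} {i} = Vec.lookup⇒[]= i B

∈⇒! : ∀ {n} {B : Subset n} {i} → i ∈ B → B ! i ≡ true
∈⇒! = Vec.[]=⇒lookup

Fits : ∀ {n} → Subset n → WPart n → Set
Fits B = All (λ Sk → ∣ B ∩ proj₁ Sk ∣ ≡ proj₂ Sk)

-- The equation for a merged block is the sum of those for its two parts, so a set that fits a
-- weighted partition fits all larger ones.
Fits-⋖ : ∀ {n} (B : Subset n) {S T : WPart n} → S ⋖ T → Fits B S → Fits B T
Fits-⋖ B (rest , Th , A , a , b , _ , (A⊆Th , _) , T↭ , S↭) fits with ↭.All-resp-↭ S↭ fits
... | ∣B∩A∣≡a ∷ ∣B∩Th∖A∣≡b ∷ fits-rest = ↭.All-resp-↭ (↭-sym T↭)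
  (trans (sym (∣∩∣-split B A⊆Th)) (cong₂ ℕ._+_ ∣B∩A∣≡a ∣B∩Th∖A∣≡b) ∷ fits-rest)

Fits-≤NC : ∀ {n d} (B : Subset n) {S T : NC n d} → S ≤NC T → Fits B (proj₁ S) → Fits B (proj₁ T)
Fits-≤NC B ε               fits = fits
Fits-≤NC B (inj₁ S⋖T ◅ ps) fits = Fits-≤NC B ps (Fits-⋖ B S⋖T fits)
Fits-≤NC B (inj₂ S↭T ◅ ps) fits = Fits-≤NC B ps (↭.All-resp-↭ S↭T fits)

≈̂⇒≤̂ : ∀ {n d} (x y : NCHat n d) → x ≈̂ y → x ≤̂ y × y ≤̂ x
≈̂⇒≤̂ nothing  nothing  _ = tt , tt
≈̂⇒≤̂ (just x) (just y) p = inj₂ p ◅ ε , inj₂ (↭-sym p) ◅ ε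

-- The partition into components.

module ComponentBlocks
  {n : ℕ} (𝓜 : Subset n → Set) (signedExchange : SignedExchange 𝓜)
  (stable⇒dec : {Q : Set} → (¬ ¬ Q → Q) → Dec Q)
  where
  open Components 𝓜 signedExchange stable⇒dec public

  ~-decSetoid : DecSetoid _ _
  ~-decSetoid = record
    { Carrier = Fin n ; _≈_ = _~_
    ; isDecEquivalence = record
      { isEquivalence = record { refl = ~-refl ; sym = ~-sym ; trans = ~-trans } ; _≟_ = _~?_ } }

  -- One element per component, so that `blocks` lists each component once.
  representatives : List (Fin n)
  representatives = deduplicate _~?_ (allFin n)

  blocks : List (Subset n)
  blocks = map component representatives

  ∈component⁺ : ∀ {i j} → i ~ j → j ∈ component i
  ∈component⁺ {i} i~j = !⇒∈ (∈setOf⁺ (i ~?_) i~j)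

  ∈component⁻ : ∀ {i j} → j ∈ component i → i ~ j
  ∈component⁻ {i} j∈ = ∈setOf⁻ (i ~?_) (∈⇒! j∈)

  ∈blocks⁻ : ∀ {S} → S ∈ˡ blocks → ∃[ i ] (S ≡ component i)
  ∈blocks⁻ S∈ with ∈-map⁻ component S∈
  ... | i , _ , S≡ = i , S≡

  blocks-separators : All Separator blocks
  blocks-separators = All.map⁺ (All.universal component-separator representatives)

  blocks-isNCPartition : IsNCPartition blocks
  blocks-isNCPartition = record
    { nonempty    = All.map⁺ (All.universal (λ i → i , ∈component⁺ ~-refl) representatives)
    ; disjoint    = AllPairs.map⁺ (AllPairs.map apart distinct)
    ; covering    = λ i → Any.map⁺ (Any.map ∈component⁺
                      (Any.deduplicate⁺ _~?_ (λ y~x x~i → ~-trans y~x x~i) (loseˡ (∈-allFin i) ~-refl)))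
    ; noncrossing = AllPairs.map⁺ (AllPairs.map uncrossed distinct)
    }
    where
    distinct : AllPairs (λ i j → ¬ (i ~ j)) representatives
    distinct = deduplicate-! ~-decSetoid (allFin n)
    apart : ∀ {i j} → ¬ (i ~ j) → Empty (component i ∩ component j)
    apart {i} {j} i≁j (x , x∈) with Sub.x∈p∩q⁻ (component i) (component j) x∈
    ... | x∈i , x∈j = i≁j (~-trans (∈component⁻ x∈i) (~-sym (∈component⁻ x∈j)))
    uncrossed : ∀ {i j} → ¬ (i ~ j) → ¬ Cross (component i) (component j) × ¬ Cross (component j) (component i)
    uncrossed i≁j = Uncrossed⇒¬Cross λ b∈ d∈ x∈ y∈ b<x<d → components-noncrossing i≁j
      (∈component⁻ y∈) (∈component⁻ x∈) (∈component⁻ b∈) (∈component⁻ d∈) b<x<d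

-- Faces of the positroid polytope and their weighted partitions.

module Positroid (R : CompleteOrderedField) (n d : ℕ) where
  open CompleteOrderedField R hiding (zero) renaming (refl to ≈-refl; sym to ≈-sym; trans to ≈-trans)
  open WithField R
  open OrderedField R
  open Exterior R
  open IntegerCoefficients commutativeRing using (solve; _:=_; _:+_; _:*_; :-_; :0; :1)
  open import Algebra.Properties.Semiring.Mult semiring renaming (_×_ to _×′_) using ()

  ·-ins : ∀ {n} (w : Fin n → Carrier) i (B : Subset n) → B ! i ≡ false → w · e (ins i B) ≈ w · e B + w i
  ·-ins w zero    (false ∷ B) _ = solve 2 (λ x s → x :* :1 :+ s := x :* :0 :+ s :+ x) ≈-refl (w zero) ((w ∘ suc) · e B)
  ·-ins w (suc i) (b ∷ B) i∉B = ≈-trans (+-congˡ (·-ins (w ∘ suc) i B i∉B)) (≈-sym (+-assoc _ _ _))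

  ·-del : ∀ {n} (w : Fin n → Carrier) i (B : Subset n) → B ! i ≡ true → w · e (del i B) ≈ w · e B + - w i
  ·-del w i B i∈B = ≈-trans (solve 2 (λ x y → x := x :+ y :+ :- y) ≈-refl (w · e (del i B)) (w i))
    (+-congʳ (≈-trans (≈-sym (·-ins w i (del i B) (!-del i B))) (reflexive (cong (λ Z → w · e Z) (ins-del i B i∈B)))))

  ·-∩ : ∀ {n} (w : Fin n → Carrier) (B T : Subset n) → w · e B ≈ w · e (B ∩ T) + w · e (B ∩ ∁ T)
  ·-∩ w [] [] = solve 0 (:0 := :0 :+ :0) ≈-refl
  ·-∩ w (b ∷ B) (t ∷ T) = ≈-trans (+-congˡ (·-∩ (w ∘ suc) B T)) (split b t)
    where
    p = (w ∘ suc) · e (B ∩ T)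
    q = (w ∘ suc) · e (B ∩ ∁ T)
    split : ∀ b t → w zero * (if b then 1# else 0#) + (p + q) ≈
            w zero * (if b ∧ t then 1# else 0#) + p + (w zero * (if b ∧ not t then 1# else 0#) + q)
    split false _     = solve 3 (λ w p q → w :* :0 :+ (p :+ q) := w :* :0 :+ p :+ (w :* :0 :+ q)) ≈-refl (w zero) p q
    split true  true  = solve 3 (λ w p q → w :* :1 :+ (p :+ q) := w :* :1 :+ p :+ (w :* :0 :+ q)) ≈-refl (w zero) p q
    split true  false = solve 3 (λ w p q → w :* :1 :+ (p :+ q) := w :* :0 :+ p :+ (w :* :1 :+ q)) ≈-refl (w zero) p q

  ·-constant : ∀ {n} (w : Fin n → Carrier) (B : Subset n) c → (∀ {i} → i ∈ B → w i ≈ c) → w · e B ≈ ∣ B ∣ ×′ c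
  ·-constant w []          c h = ≈-refl
  ·-constant w (false ∷ B) c h = ≈-trans (+-cong (zeroʳ _) (·-constant (w ∘ suc) B c (h ∘ Vec.there))) (+-identityˡ _)
  ·-constant w (true ∷ B)  c h = +-cong (≈-trans (*-identityʳ _) (h Vec.here)) (·-constant (w ∘ suc) B c (h ∘ Vec.there))

  -- A block contributes its constant value of w times the number of chosen elements in it, which is
  -- the same for B and B′.
  ·-blockwise : ∀ {n} (w : Fin n → Carrier) P → All Nonempty P → AllPairs (λ S T → Empty (S ∩ T)) P →
    All (λ T → ∀ {x y} → x ∈ T → y ∈ T → w x ≈ w y) P →
    ∀ B B′ → (∀ {i} → i ∈ B → Any (i ∈_) P) → (∀ {i} → i ∈ B′ → Any (i ∈_) P) →
    All (λ T → ∣ B ∩ T ∣ ≡ ∣ B′ ∩ T ∣) P → w · e B ≈ w · e B′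
  ·-blockwise w [] [] [] [] B B′ cov cov′ [] = reflexive (cong (λ Z → w · e Z)
    (trans (Sub.Empty-unique {p = B} (λ (i , i∈) → case cov i∈ of λ ()))
      (sym (Sub.Empty-unique {p = B′} (λ (i , i∈) → case cov′ i∈ of λ ())))))
  ·-blockwise w (T ∷ P) ((t , t∈T) ∷ ne) (ds ∷ dj) (c ∷ cs) B B′ cov cov′ (q ∷ qs) = begin
    w · e B                               ≈⟨ ·-∩ w B T ⟩
    w · e (B ∩ T) + w · e (B ∩ ∁ T)       ≈⟨ +-cong onT (·-blockwise w P ne dj cs _ _ (outside cov) (outside cov′) rest) ⟩
    w · e (B′ ∩ T) + w · e (B′ ∩ ∁ T)     ≈⟨ ·-∩ w B′ T ⟨
    w · e B′                              ∎
    where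
    open import Relation.Binary.Reasoning.Setoid setoid
    onT : w · e (B ∩ T) ≈ w · e (B′ ∩ T)
    onT = ≈-trans (·-constant w (B ∩ T) (w t) (λ i∈ → c (proj₂ (Sub.x∈p∩q⁻ B T i∈)) t∈T))
      (≈-trans (reflexive (cong (_×′ w t) q))
        (≈-sym (·-constant w (B′ ∩ T) (w t) (λ i∈ → c (proj₂ (Sub.x∈p∩q⁻ B′ T i∈)) t∈T))))
    outside : ∀ {B} → (∀ {i} → i ∈ B → Any (i ∈_) (T ∷ P)) → ∀ {i} → i ∈ B ∩ ∁ T → Any (i ∈_) P
    outside {B} cov i∈ with Sub.x∈p∩q⁻ B (∁ T) i∈
    ... | i∈B , i∈∁T with cov i∈B
    ...   | here i∈T  = ⊥-elim (Sub.x∈∁p⇒x∉p i∈∁T i∈T)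
    ...   | there i∈P = i∈P
    rest : All (λ S → ∣ (B ∩ ∁ T) ∩ S ∣ ≡ ∣ (B′ ∩ ∁ T) ∩ S ∣) P
    rest = All.zipWith (λ {S} (d , q) → trans (cong ∣_∣ (∩∁-∩ B T S d))
      (trans q (sym (cong ∣_∣ (∩∁-∩ B′ T S d))))) (ds , qs)

  -- Exhaustive search on the first membership bit; it will supply a w-maximal basis for each
  -- functional w.
  maximise : ∀ {n} {P : Subset n → Set} → (∀ B → Dec (P B)) → (f : Subset n → Carrier) →
             (∃[ B ] (P B × (∀ B′ → P B′ → f B′ ≤ f B))) ⊎ (∀ B → ¬ P B)
  maximise {zero} P? f with P? []
  ... | yes P[] = inj₁ ([] , P[] , λ { [] _ → ≤-refl })
  ... | no ¬P[] = inj₂ λ { [] → ¬P[] }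
  maximise {suc n} P? f with maximise (P? ∘ (false ∷_)) (f ∘ (false ∷_)) | maximise (P? ∘ (true ∷_)) (f ∘ (true ∷_))
  ... | inj₂ none | inj₂ none′ = inj₂ λ { (false ∷ B) → none B ; (true ∷ B) → none′ B }
  ... | inj₁ (B , PB , max) | inj₂ none′ = inj₁ (false ∷ B , PB , λ
    { (false ∷ B′) → max B′ ; (true ∷ B′) PB′ → ⊥-elim (none′ B′ PB′) })
  ... | inj₂ none | inj₁ (B , PB , max) = inj₁ (true ∷ B , PB , λ
    { (true ∷ B′) → max B′ ; (false ∷ B′) PB′ → ⊥-elim (none B′ PB′) })
  ... | inj₁ (B , PB , max) | inj₁ (C , PC , max′) with ≤-total (f (false ∷ B)) (f (true ∷ C))
  ...   | inj₁ B≤C = inj₁ (true ∷ C , PC , λ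
    { (false ∷ B′) PB′ → ≤-trans (max B′ PB′) B≤C ; (true ∷ B′) → max′ B′ })
  ...   | inj₂ C≤B = inj₁ (false ∷ B , PB , λ
    { (false ∷ B′) → max B′ ; (true ∷ B′) PB′ → ≤-trans (max′ B′ PB′) C≤B })

  module _ (A : Fin d → Fin n → Carrier) (tnn : TNN A) where

    -- The bases of the matroid whose polytope is the face of w.
    MaxBasis : Point n → Subset n → Set
    MaxBasis w B = IsBasis A B × (∀ B′ → IsBasis A B′ → w · e B′ ≤ w · e B)

    isBasis? : ∀ B → Dec (IsBasis A B)
    isBasis? B = stable⇒dec λ ¬¬basis →
      decidable-stable (∣ B ∣ ℕ.≟ d) (λ ∣B∣≢d → ¬¬basis (∣B∣≢d ∘ proj₁)) , λ minor≈0 → ¬¬basis λ basis → proj₂ basis minor≈0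

    maxBasis-signedExchange : ∀ w → SignedExchange (MaxBasis w)
    maxBasis-signedExchange w I J i i∉I i∈J ((∣Ii∣ , Ii≉0) , Ii-max) ((∣Ji∣ , Ji≉0) , Ji-max) =
      conclude (opposite-term n (sign I J) (exchangeTerm ω I J) terms≥0 (plücker-sum d A I J) i term-i≉0)
      where
      ω = vol d A
      -- All sets in the relation have size d because I + i and J - i do; only then are their
      -- coordinates minors.
      ∣ins∣≡d : ∀ {j} → I ! j ≡ false → ∣ ins j I ∣ ≡ d
      ∣ins∣≡d {j} j∉I = trans (∣ins∣ j I j∉I) (trans (sym (∣ins∣ i I i∉I)) ∣Ii∣)
      ∣del∣≡d : ∀ {j} → J ! j ≡ true → ∣ del j J ∣ ≡ d
      ∣del∣≡d {j} j∈J = trans (ℕ.suc-injective (trans (∣del∣ j J j∈J) (sym (∣del∣ i J i∈J)))) ∣Ji∣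
      ω≥0 : ∀ {B} → ∣ B ∣ ≡ d → 0# ≤ ω B
      ω≥0 {B} ∣B∣ = ≤-resp ≈-refl (minor≈vol A B ∣B∣) (tnn B ∣B∣)
      basis⇒ω≉0 : ∀ {B} → ∣ B ∣ ≡ d → ¬ (minor A B ≈ 0#) → ¬ (ω B ≈ 0#)
      basis⇒ω≉0 {B} ∣B∣ B≉0 ωB≈0 = B≉0 (≈-trans (minor≈vol A B ∣B∣) ωB≈0)
      terms≥0 : ∀ j → 0# ≤ exchangeTerm ω I J j
      terms≥0 j with I ! j in Ij | J ! j in Jj
      ... | true  | _     = ≤-refl
      ... | false | false = ≤-refl
      ... | false | true  = *-nonneg (ω≥0 (∣ins∣≡d Ij)) (ω≥0 (∣del∣≡d Jj))
      term-i≉0 : ¬ (exchangeTerm ω I J i ≈ 0#)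
      term-i≉0 rewrite i∉I | i∈J = *-≉0 (basis⇒ω≉0 ∣Ii∣ Ii≉0) (basis⇒ω≉0 ∣Ji∣ Ji≉0)
      weights : ∀ {j} → I ! j ≡ false → J ! j ≡ true → w · e (ins j I) + w · e (del j J) ≈ w · e I + w · e J
      weights {j} j∉I j∈J = ≈-trans (+-cong (·-ins w j I j∉I) (·-del w j J j∈J))
        (solve 3 (λ x y z → x :+ z :+ (y :+ :- z) := x :+ y) ≈-refl (w · e I) (w · e J) (w j))
      -- The old and new pairs have equal total weight. If one new basis is at most the maximum, the
      -- other must reach it.
      attains : ∀ {x y m₁ m₂} → x + y ≈ m₁ + m₂ → y ≤ m₂ → m₁ ≤ x
      attains {x} {y} {m₁} {m₂} eq y≤m₂ = ≤-resp
        (≈-trans (+-congʳ eq) (solve 2 (λ m₁ m₂ → m₁ :+ m₂ :+ :- m₂ := m₁) ≈-refl m₁ m₂))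
        (solve 2 (λ x y → x :+ y :+ :- y := x) ≈-refl x y)
        (+-mono₂ ≤-refl (neg-mono y≤m₂))
      conclude : ∃[ j ] (sign I J j ≢ sign I J i × ¬ (exchangeTerm ω I J j ≈ 0#)) →
        ∃[ j ] (I ! j ≡ false × J ! j ≡ true × sign I J j ≢ sign I J i × MaxBasis w (ins j I) × MaxBasis w (del j J))
      conclude (j , signs≢ , term≉0) with I ! j in Ij | J ! j in Jj
      ... | true  | _     = ⊥-elim (term≉0 ≈-refl)
      ... | false | false = ⊥-elim (term≉0 ≈-refl)
      ... | false | true  = j , Ij , Jj , signs≢ ,
        (insBasis , λ B′ b → ≤-trans (Ii-max B′ b) (attains balance (Ji-max _ delBasis))) ,
        (delBasis , λ B′ b → ≤-trans (Ji-max B′ b)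
          (attains (≈-trans (+-comm _ _) (≈-trans balance (+-comm _ _))) (Ii-max _ insBasis)))
        where
        insBasis : IsBasis A (ins j I)
        insBasis = ∣ins∣≡d Ij , λ e → term≉0 (≈-trans (*-congʳ (≈-trans (≈-sym (minor≈vol A _ (∣ins∣≡d Ij))) e)) (zeroˡ _))
        delBasis : IsBasis A (del j J)
        delBasis = ∣del∣≡d Jj , λ e → term≉0 (≈-trans (*-congˡ (≈-trans (≈-sym (minor≈vol A _ (∣del∣≡d Jj))) e)) (zeroʳ _))
        balance : w · e (ins j I) + w · e (del j J) ≈ w · e (ins i I) + w · e (del i J)
        balance = ≈-trans (weights Ij Jj) (≈-sym (weights i∉I i∈J))

    module C (w : Point n) = ComponentBlocks (MaxBasis w) (maxBasis-signedExchange w) stable⇒dec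

    ∣maxBasis∩block∣ : ∀ w {B B′} → MaxBasis w B → MaxBasis w B′ → ∀ {S} → S ∈ˡ C.blocks w → ∣ B ∩ S ∣ ≡ ∣ B′ ∩ S ∣
    ∣maxBasis∩block∣ w B∈ B′∈ S∈ = C.∣∩separator∣ w (proj₁ ∘ proj₁) (All.lookup (C.blocks-separators w) S∈) B∈ B′∈

    -- Two maximal bases I + x and I + y have equal weight, so w x ≈ w y. Level sets of w are
    -- therefore separators.
    weight-constant : ∀ w {i j} → C._~_ w i j → w i ≈ w j
    weight-constant w {i} {j} i~j = ∈setOf⁻ same-weight? (i~j (setOf same-weight?)
      (separator λ {x} {y} exy x∈ → ∈setOf⁺ same-weight? (≈-trans (∈setOf⁻ same-weight? x∈) (E⇒≈ exy)))
      (∈setOf⁺ same-weight? ≈-refl))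
      where
      open C w
      same-weight? : ∀ k → Dec (w i ≈ w k)
      same-weight? k = stable⇒dec λ ¬¬e → x-y≈0⇒x≈y (≈0-stable λ ¬e → ¬¬e λ e → ¬e (x≈y⇒x-y≈0 e))
      E⇒≈ : ∀ {x y} → E x y → w x ≈ w y
      E⇒≈ {x} {y} (I , x∉I , y∉I , (Ix , Ix-max) , (Iy , Iy-max)) = begin
        w x                                 ≈⟨ solve 2 (λ x s → x := s :+ x :+ :- s) ≈-refl (w x) (w · e I) ⟩
        w · e I + w x + - (w · e I)         ≈⟨ +-congʳ (·-ins w x I x∉I) ⟨
        w · e (ins x I) + - (w · e I)       ≈⟨ +-congʳ (≤-antisym (Iy-max _ Ix) (Ix-max _ Iy)) ⟩
        w · e (ins y I) + - (w · e I)       ≈⟨ +-congʳ (·-ins w y I y∉I) ⟩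
        w · e I + w y + - (w · e I)         ≈⟨ solve 2 (λ x s → x := s :+ x :+ :- s) ≈-refl (w y) (w · e I) ⟨
        w y                                 ∎
        where open import Relation.Binary.Reasoning.Setoid setoid

    Maximal : Point n → Point n → Set
    Maximal w x = InPolytope A x × (∀ y → InPolytope A y → w · y ≤ w · x)

    vertex-∈ : ∀ {B} → IsBasis A B → InPolytope A (e B)
    vertex-∈ {B} basis = 1 , (λ _ → 1#) , (λ _ → B) , (λ _ → 0≤1) , +-identityʳ 1# , (λ _ → basis) ,
      λ i → solve 1 (λ x → x := :1 :* x :+ :0) ≈-refl (e B i)

    ·-combination : ∀ (w x : Point n) k (λs : Fin k → Carrier) (Bs : Fin k → Subset n) →
      (∀ i → x i ≈ sumF k (λ j → λs j * e (Bs j) i)) → w · x ≈ sumF k (λ j → λs j * (w · e (Bs j)))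
    ·-combination w x k λs Bs x≈ = ≈-trans
      (sumF-cong n λ i → ≈-trans (*-congˡ (x≈ i)) (≈-sym (sumF-* k (w i) (λ j → λs j * e (Bs j) i))))
      (≈-trans (sumF-swap n k (λ i j → w i * (λs j * e (Bs j) i)))
        (sumF-cong k λ j → ≈-trans
          (sumF-cong n λ i → solve 3 (λ w l x → w :* (l :* x) := l :* (w :* x)) ≈-refl (w i) (λs j) (e (Bs j) i))
          (sumF-* n (λs j) (λ i → w i * e (Bs j) i))))

    sumF-*ʳ : ∀ k (λs : Fin k → Carrier) m → sumF k λs ≈ 1# → sumF k (λ j → λs j * m) ≈ m
    sumF-*ʳ k λs m Σ≈1 = ≈-trans (sumF-cong k λ j → *-comm (λs j) m)
      (≈-trans (sumF-* k m λs) (≈-trans (*-congˡ Σ≈1) (*-identityʳ m)))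

    bounded-on-polytope : ∀ {w m} → (∀ B → IsBasis A B → w · e B ≤ m) → ∀ y → InPolytope A y → w · y ≤ m
    bounded-on-polytope {w} {m} bound y (k , λs , Bs , λs≥0 , Σ≈1 , bases , y≈) =
      ≤-resp (≈-sym (·-combination w y k λs Bs y≈)) (sumF-*ʳ k λs m Σ≈1)
        (sumF-mono k λ j → *-monoˡ (λs≥0 j) (bound (Bs j) (bases j)))

    maxBasis⇒maximal : ∀ {w B} → MaxBasis w B → Maximal w (e B)
    maxBasis⇒maximal (basis , max) = vertex-∈ basis , bounded-on-polytope max

    maximal⇒maxBasis : ∀ {w B} → IsBasis A B → Maximal w (e B) → MaxBasis w B
    maximal⇒maxBasis basis (_ , max) = basis , λ B′ basis′ → max (e B′) (vertex-∈ basis′)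

    -- A convex combination of bases is w-maximal only if every basis of nonzero coefficient is.
    maximal-mono : ∀ {w w′ B} → MaxBasis w B → (∀ {B} → MaxBasis w B → MaxBasis w′ B) →
                   ∀ x → Maximal w x → Maximal w′ x
    maximal-mono {w} {w′} {B} B-max w⊆w′ x ((k , λs , Bs , λs≥0 , Σ≈1 , bases , x≈) , x-max) =
      (k , λs , Bs , λs≥0 , Σ≈1 , bases , x≈) ,
      λ y y∈ → ≤-trans (bounded-on-polytope (proj₂ (w⊆w′ B-max)) y y∈) (≤-reflexive (≈-sym w′x≈m′))
      where
      m = w · e B
      m′ = w′ · e B
      -- The deficits are nonnegative and add up to m - w · x, which is zero, so each of them
      -- vanishes.
      deficit≥0 : ∀ j → 0# ≤ λs j * (m + - (w · e (Bs j)))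
      deficit≥0 j = *-nonneg (λs≥0 j) (x≤y⇒0≤y-x (proj₂ B-max (Bs j) (bases j)))
      Σdeficit≈0 : sumF k (λ j → λs j * (m + - (w · e (Bs j)))) ≈ 0#
      Σdeficit≈0 = begin
        sumF k (λ j → λs j * (m + - (w · e (Bs j))))
          ≈⟨ sumF-cong k (λ j → solve 3 (λ l m x → l :* (m :+ :- x) := :- :1 :* (l :* x) :+ l :* m) ≈-refl (λs j) m (w · e (Bs j))) ⟩
        sumF k (λ j → - 1# * (λs j * (w · e (Bs j))) + λs j * m)
          ≈⟨ sumF-linear k (- 1#) (λ j → λs j * (w · e (Bs j))) (λ j → λs j * m) ⟩
        - 1# * sumF k (λ j → λs j * (w · e (Bs j))) + sumF k (λ j → λs j * m)
          ≈⟨ +-cong (*-congˡ (≈-sym (·-combination w x k λs Bs x≈))) (sumF-*ʳ k λs m Σ≈1) ⟩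
        - 1# * (w · x) + m
          ≈⟨ +-congʳ (*-congˡ (≤-antisym (bounded-on-polytope (proj₂ B-max) x (k , λs , Bs , λs≥0 , Σ≈1 , bases , x≈))
                                          (x-max (e B) (vertex-∈ (proj₁ B-max))))) ⟩
        - 1# * m + m
          ≈⟨ solve 1 (λ m → :- :1 :* m :+ m := :0) ≈-refl m ⟩
        0# ∎
        where open import Relation.Binary.Reasoning.Setoid setoid
      supported : ∀ j → λs j * (w′ · e (Bs j)) ≈ λs j * m′
      supported j with (λs j) ≟0
      ... | yes λ≈0 = ≈-trans (*-congʳ λ≈0) (≈-trans (solve 2 (λ x y → :0 :* x := :0 :* y) ≈-refl (w′ · e (Bs j)) m′) (*-congʳ (≈-sym λ≈0)))
      ... | no λ≉0 = *-congˡ (≤-antisym (proj₂ (w⊆w′ B-max) (Bs j) (bases j)) (proj₂ (w⊆w′ Bj-max) B (proj₁ B-max)))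
        where
        m≈ : m ≈ w · e (Bs j)
        m≈ = x-y≈0⇒x≈y (xy≈0⇒y≈0 λ≉0 (sumF≈0⇒≈0 k deficit≥0 Σdeficit≈0 j))
        Bj-max : MaxBasis w (Bs j)
        Bj-max = bases j , λ B′ basis′ → ≤-trans (proj₂ B-max B′ basis′) (≤-reflexive m≈)
      w′x≈m′ : w′ · x ≈ m′
      w′x≈m′ = ≈-trans (·-combination w′ x k λs Bs x≈) (≈-trans (sumF-cong k supported) (sumF-*ʳ k λs m′ Σ≈1))

    -- Refines `IsFace`: the functional comes with a maximal basis, from which the block weights are
    -- read off.
    Described : (Point n → Set) → Set
    Described F = (∀ x → ¬ F x) ⊎
      (∃[ w ] ∃[ B ] (MaxBasis w B × (∀ x → (F x → Maximal w x) × (Maximal w x → F x))))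

    describe : (F : Face A) → Described (proj₁ F)
    describe (F , inj₁ empty) = inj₁ empty
    describe (F , inj₂ (w , F⇔max)) with maximise isBasis? (λ B → w · e B)
    ... | inj₁ (B , basis , max) = inj₂ (w , B , (basis , max) , F⇔max)
    ... | inj₂ none = inj₁ λ x Fx → no-points (proj₁ (proj₁ (F⇔max x) Fx))
      where
      no-points : ∀ {x} → ¬ InPolytope A x
      -- An empty combination has coefficient sum 0 instead of 1.
      no-points (zero  , _ , _  , _ , 0≈1 , _ , _)   = 0≉1 0≈1
      no-points (suc k , _ , Bs , _ , _ , bases , _) = none (Bs zero) (bases zero)

    -- The weight of a component is its rank in the matroid of w-maximal bases.
    partition : ∀ w {B} → MaxBasis w B → NC n d
    partition w {B} ((∣B∣≡d , _) , _) = label B (C.blocks w) , label-isWNC B ∣B∣≡d (C.blocks-isNCPartition w)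

    toNC : ∀ {F} → Described F → NCHat n d
    toNC (inj₁ _)                   = nothing
    toNC (inj₂ (w , B , B-max , _)) = just (partition w B-max)

    -- Exchanges between w-maximal bases are exchanges between w′-maximal ones, so the components of
    -- w are finer. The chain of covers uses the weights of B, which agree with those of B′ on the
    -- blocks of w′ as B is w′-maximal too.
    partition-mono : ∀ {w w′ B B′} (B-max : MaxBasis w B) (B′-max : MaxBasis w′ B′) →
      (∀ {B} → MaxBasis w B → MaxBasis w′ B) → partition w B-max ≤NC partition w′ B′-max
    partition-mono {w} {w′} {B} {B′} B-max@((∣B∣≡d , _) , _) B′-max w⊆w′ =
      ⊑⇒≤NC B ∣B∣≡d (length (C.blocks w)) ℕ.≤-refl (C.blocks-isNCPartition w) (C.blocks-isNCPartition w′)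
        refines _ (label-isWNC B ∣B∣≡d (C.blocks-isNCPartition w′))
      ◅◅ (inj₂ (↭-reflexive relabel) ◅ ε)
      where
      module W = C w
      module W′ = C w′
      relabel : label B (C.blocks w′) ≡ label B′ (C.blocks w′)
      relabel = List.map-cong-local (All.tabulate λ {S} S∈ → cong (S ,_) (∣maxBasis∩block∣ w′ (w⊆w′ B-max) B′-max S∈))
      ~-mono : ∀ {i j} → i W.~ j → i W′.~ j
      ~-mono i~j S sep = i~j S (W.separator λ (I , x∉I , y∉I , Ix , Iy) →
        W′.Separator.closed sep (I , x∉I , y∉I , w⊆w′ Ix , w⊆w′ Iy))
      refines : W.blocks ⊑ W′.blocks
      refines A∈ with W.∈blocks⁻ A∈
      ... | i , refl with findˡ (covering (W′.blocks-isNCPartition) i)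
      ...   | T , T∈ , i∈T with W′.∈blocks⁻ T∈
      ...     | r , refl = T , T∈ , λ k∈ → W′.∈component⁺
                (W′.~-trans (W′.∈component⁻ i∈T) (~-mono (W.∈component⁻ k∈)))

    -- w′ is constant on its own components, so the w′-weight of a basis depends only on
    -- the sizes of its intersections with them.
    partition-reflects : ∀ {w w′ B B′} (B-max : MaxBasis w B) (B′-max : MaxBasis w′ B′) →
      partition w B-max ≤NC partition w′ B′-max → ∀ {C} → MaxBasis w C → MaxBasis w′ C
    partition-reflects {w} {w′} {B} {B′} B-max B′-max le {C} C-max@(basis , _) =
      basis , λ D D-basis → ≤-trans (proj₂ B′-max D D-basis) (≤-reflexive (≈-sym same-weight))
      where
      fits : Fits C (label B (C.blocks w))
      fits = All.map⁺ (All.tabulate (∣maxBasis∩block∣ w C-max B-max))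
      part′ = C.blocks-isNCPartition w′
      constant : ∀ {T} → T ∈ˡ C.blocks w′ → ∀ {x y} → x ∈ T → y ∈ T → w′ x ≈ w′ y
      constant T∈ x∈ y∈ with C.∈blocks⁻ w′ T∈
      ... | r , refl = weight-constant w′ (C.~-trans w′ (C.~-sym w′ (C.∈component⁻ w′ x∈)) (C.∈component⁻ w′ y∈))
      same-weight : w′ · e C ≈ w′ · e B′
      same-weight = ·-blockwise w′ (C.blocks w′) (nonempty part′) (disjoint part′) (All.tabulate constant) C B′
        (λ {i} _ → covering part′ i) (λ {i} _ → covering part′ i) (All.map⁻ (Fits-≤NC C le fits))

    -- The inclusion is needed only at the vertices `e C` of maximal bases C, which turns it into an
    -- inclusion of maximal bases.
    ⊆F⇒≤̂ : ∀ {F G} (dF : Described F) (dG : Described G) → (∀ x → F x → G x) → toNC dF ≤̂ toNC dG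
    ⊆F⇒≤̂ (inj₁ _) _ _ = tt
    ⊆F⇒≤̂ (inj₂ (w , B , B-max , F⇔)) (inj₁ G-empty) F⊆G =
      G-empty (e B) (F⊆G (e B) (proj₂ (F⇔ (e B)) (maxBasis⇒maximal {w} {B} B-max)))
    ⊆F⇒≤̂ (inj₂ (w , B , B-max , F⇔)) (inj₂ (w′ , B′ , B′-max , G⇔)) F⊆G =
      partition-mono {w} {w′} B-max B′-max λ {C} C-max → maximal⇒maxBasis {w′} {C} (proj₁ C-max)
        (proj₁ (G⇔ (e C)) (F⊆G (e C) (proj₂ (F⇔ (e C)) (maxBasis⇒maximal {w} {C} C-max))))

    ≤̂⇒⊆F : ∀ {F G} (dF : Described F) (dG : Described G) → toNC dF ≤̂ toNC dG → ∀ x → F x → G x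
    ≤̂⇒⊆F (inj₁ F-empty) _ _ x Fx = ⊥-elim (F-empty x Fx)
    ≤̂⇒⊆F (inj₂ (w , B , B-max , F⇔)) (inj₂ (w′ , B′ , B′-max , G⇔)) le x Fx =
      proj₂ (G⇔ x) (maximal-mono {w} {w′} B-max (partition-reflects {w} {w′} B-max B′-max le) x (proj₁ (F⇔ x) Fx))

theorem9p3 : (R : CompleteOrderedField) (n d : ℕ) →
    let open CompleteOrderedField R using (Carrier) in
    let open WithField R in
    (A : Fin d → Fin n → Carrier) → HasRank A → TNN A →
    Σ (Face A → NCHat n d) (λ φ →
    ((F G : Face A) → φ F ≈̂ φ G → (F ⊆F G × G ⊆F F)) ×
    ((F G : Face A) → (F ⊆F G → φ F ≤̂ φ G) × (φ F ≤̂ φ G → F ⊆F G)))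
theorem9p3 R n d A _ tnn = φ ,
  -- Injectivity is a case of reflecting the order: equal weighted partitions lie below each other.
  (λ F G φF≈φG → case ≈̂⇒≤̂ (φ F) (φ G) φF≈φG of λ (le , ge) →
     ≤̂⇒⊆F A tnn (describe A tnn F) (describe A tnn G) le , ≤̂⇒⊆F A tnn (describe A tnn G) (describe A tnn F) ge) ,
  (λ F G → ⊆F⇒≤̂ A tnn (describe A tnn F) (describe A tnn G) , ≤̂⇒⊆F A tnn (describe A tnn F) (describe A tnn G))
  where
  open Positroid R n d
  φ = λ F → toNC A tnn (describe A tnn F)
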